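{- For every $k\geq 2$, $\tau^P_{2k}\geq \frac{1}{2}$ and $\tau^P_{2k+1}\geq\frac{2}{5}$.
   Context: For a pure simplicial complex $\Delta$, $T(\Delta)$ is the minimum size of a set of vertices meeting every facet, and $\tau(\Delta)=T(\Delta)/f_0(\Delta)$ where $f_0(\Delta)$ is the number of vertices. For $d\ge2$, $$\tau^P_d=\limsup_{n\to\infty}\max\{\tau(\partial Q): Q \text{ a simplicial } d\text{ -polytope with } n \text{ vertices}\},$$ where $\partial Q$ is the boundary complex of $Q$ (vertex sets of proper faces). -}

module Defs where

open import Data.Nat as ℕ using (ℕ; zero; suc)
open import Data.Integer using (+_)
open import Data.Rational using (ℚ; 0ℚ; _+_; _*_; _-_; _≤_; _/_; Positive)
open import Data.Fin using (Fin; zero; suc)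
open import Data.Fin.Subset using (Subset; _∈_; _⊆_; ⁅_⁆; ∣_∣)
open import Data.Product using (Σ; ∃; _×_; _,_)
open import Function using (_∘_; _⇔_)
open import Relation.Binary.PropositionalEquality using (_≡_; _≢_)

Point : ℕ → Set
Point d = Fin d → ℚ

dot : ∀ {d} → Point d → Point d → ℚ
dot {zero}  _ _ = 0ℚ
dot {suc d} a x = a zero * x zero + dot (a ∘ suc) (x ∘ suc)

-- A configuration of n labelled points in ℚ^d; Q = conv(v 0, …, v (n-1)).
Config : ℕ → ℕ → Set
Config d n = Fin n → Point d

CutOutBy : ∀ {d n} → Config d n → Point d → ℚ → Subset n → Set
CutOutBy v a b F = (∀ i → dot a (v i) ≤ b) × (∀ i → (dot a (v i) ≡ b) ⇔ (i ∈ F))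

ProperFace : ∀ {d n} → Config d n → Subset n → Set
ProperFace {d} v F = Σ (Point d) λ a → Σ ℚ λ b → (∃ λ j → a j ≢ 0ℚ) × CutOutBy v a b F

Facet : ∀ {d n} → Config d n → Subset n → Set
Facet {n = n} v F = ProperFace v F × (∀ (G : Subset n) → ProperFace v G → F ⊆ G → G ⊆ F)

FullDimensional : ∀ {d n} → Config d n → Set
FullDimensional {d} v = ∀ (a : Point d) (b : ℚ) → (∀ i → dot a (v i) ≡ b) → ∀ j → a j ≡ 0ℚ

-- v is the vertex list of a simplicial d-polytope with n vertices:
-- d-dimensional, every v i is a vertex (so the v i are distinct and
-- f₀ = n), and every facet is a (d-1)-simplex, i.e. has exactly d vertices.
SimplicialPolytope : ∀ {d n} → Config d n → Set
SimplicialPolytope {d} v =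
  FullDimensional v × (∀ i → ProperFace v ⁅ i ⁆) × (∀ F → Facet v F → ∣ F ∣ ≡ d)

Transversal : ∀ {d n} → Config d n → Subset n → Set
Transversal v S = ∀ F → Facet v F → ∃ λ i → i ∈ S × i ∈ F

-- x ≤ τ(∂Q) = T(∂Q)/n, i.e. x·n ≤ |S| for every transversal S
-- (T is the minimum of |S| over transversals S).
TauAtLeast : ∀ {d n} → Config d n → ℚ → Set
TauAtLeast {n = n} v x = ∀ S → Transversal v S → x * (+ n / 1) ≤ + ∣ S ∣ / 1

-- c ≤ τ^P_d = limsup_n max_Q τ(∂Q):
-- for every ε > 0 and every N there are n ≥ N and a simplicial d-polytope
-- Q with n vertices such that τ(∂Q) ≥ c - ε.
TauPAtLeast : ℕ → ℚ → Set
TauPAtLeast d c =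
  ∀ (ε : ℚ) → Positive ε → ∀ (N : ℕ) →
  ∃ λ n → N ℕ.≤ n × Σ (Config d n) λ v → SimplicialPolytope v × TauAtLeast v (c - ε)

{-# OPTIONS --safe #-}
module Submission where

-- In dimension d = 2k take a cyclic polytope on r pairs of neighbouring points: the product of (t - x)(t - y) over
-- any k pairs cuts out a facet, so a transversal meets all but fewer than k pairs.
--
-- In dimension d = 2k + 1 use the curve (t, …, t^(2k), N σ + t^d), whose points lie in r distant blocks of five.
-- If Q is the product of (t - x)(t - y) over k pairs of neighbours on which σ = a, one pair per block, then rotate the
-- hyperplane Q = 0 along ± (t Q + N (σ - a)) until it reaches another point. This gives a facet, and the shape of a
-- block forces the new point to have a prescribed position in one of the k blocks. Three triples of positions (pair
-- plus new point) arise, and no position lies on all three of them. For each triple a transversal meets it in all but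
-- at most k blocks, so all but at most 3k blocks contain two points of the transversal.
--
-- General position: modulo N the curve is the moment curve, so for N large no d + 1 points lie on a hyperplane.

open import Defs
open import Data.Bool using (Bool; true; false; not)
open import Data.Bool.ListAction using (all)
open import Data.Fin using (Fin; zero; suc; toℕ; combine; remQuot)
open import Data.Fin.Patterns using (0F; 1F; 2F; 3F; 4F)
import Data.Fin.Properties as Fin
open import Data.Fin.Subset using (Subset; _∈_; _∉_; _⊆_; ⁅_⁆; ∣_∣; ⊤; ⊥; inside; outside) renaming (_-_ to _∖_)
open import Data.Fin.Subset.Properties using (_∈?_; p⊂q⇒∣p∣<∣q∣; drop-there; x∈p⇒∣p-x∣<∣p∣; x∈p∧x≢y⇒x∈p-y; ∣⊤∣≡n; x∈⁅x⁆; x∈⁅y⁆⇒x≡y; ∣⁅x⁆∣≡1; ⊆-min; ∣⊥∣≡0; anySubset?)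
open import Data.Integer as ℤ using (ℤ; +_; -[1+_]; 0ℤ; 1ℤ)
import Data.Integer.Properties as ℤ
import Data.Integer.Tactic.RingSolver as ℤRing
open import Data.List as List using (List)
open import Data.List.Membership.Propositional using () renaming (_∈_ to _∈ₗ_)
open import Data.List.Properties using (map-cong)
import Data.List.Relation.Unary.Any as Any
open import Data.Nat as ℕ using (ℕ; zero; suc; s≤s; z≤n; _!) renaming (∣_-_∣ to dist)
open import Data.Nat.Divisibility using (divides; ∣-trans; m∣m*n; m≤n⇒m!∣n!) renaming (_∣_ to _∣ℕ_)
open import Data.Nat.ListAction using (sum)
import Data.Nat.Properties as ℕ
import Data.Nat.Tactic.RingSolver as ℕRing
open import Data.Product using (Σ; ∃; _×_; _,_; proj₁; proj₂)
open import Data.Rational using (ℚ; mkℚ; 0ℚ; 1ℚ; _+_; _*_; _-_; -_; _≤_; _<_; _/_; 1/_; ↥_; ↧_; ↧ₙ_; toℚᵘ; positive; nonNegative; NonZero; Positive; ≢-nonZero)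
import Data.Rational.Properties as ℚ
open import Data.Rational.Unnormalised as ℚᵘ using (mkℚᵘ; *≡*; *<*)
import Data.Rational.Unnormalised.Properties as ℚᵘ
open import Data.Sum as Sum using (_⊎_; inj₁; inj₂)
open import Data.Vec using ([]; _∷_; here; there; tabulate; lookup; _++_; splitAt)
open import Data.Vec.Properties using (lookup∘tabulate; tabulate∘lookup; tabulate-cong; []=⇒lookup; lookup⇒[]=; lookup-++ˡ; lookup-++ʳ)
open import Function using (_∘_; _⇔_; mk⇔; Equivalence)
open import Level using (0ℓ)
open import Relation.Binary using (tri<; tri≈; tri>)
open import Relation.Binary.PropositionalEquality
open import Relation.Nullary using (¬_; Dec; yes; no; contradiction; does; ¬?)
open import Relation.Nullary.Decidable using (dec⇒maybe; dec-true; decidable-stable; from-no; _×-dec_)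
open import Tactic.RingSolver using (solve-∀)
open import Tactic.RingSolver.Core.AlmostCommutativeRing using (AlmostCommutativeRing; fromCommutativeRing)

-- A cyclic polytope is useless in odd dimension: by Gale's evenness condition each of its facets
-- contains the first or the last vertex, so two vertices meet them all. The shift N σ serves to
-- bring the unpaired vertex of a facet back among the pairs. For N large the rotating hyperplane
-- first reaches a point where ± (a - σ) / Q is largest; after cross-multiplication the moment curve
-- contributes only an error below N. This quotient depends on the distances to the pair of one
-- block, which are under control, and on the factors of Q from the other chosen blocks, which are
-- not. The latter vary by at most W = (4 r ^ 2) ^ r in total. Hence τ and σ are chosen after r, so
-- that the intended position wins by a factor above W whichever blocks are chosen, and N is chosen
-- last. The triples are 012, 013 and 342; the fraction 2/5 is two forced points in a block of five.

ℚ-ring : AlmostCommutativeRing 0ℓ 0ℓ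
ℚ-ring = fromCommutativeRing ℚ.+-*-commutativeRing λ x → dec⇒maybe (0ℚ ℚ.≟ x)

-- Integers inside ℚ, and order on ℚ

abstract
  -- Abstract, so that conversion checking does not unfold `i / 1` into its gcd normalisation;
  -- integer facts reach ℚ through the homomorphism laws.
  ι : ℤ → ℚ
  ι i = i / 1

  ι-def : ∀ i → ι i ≡ i / 1
  ι-def i = refl

  ι-0 : ι 0ℤ ≡ 0ℚ
  ι-0 = refl

  ι-1 : ι 1ℤ ≡ 1ℚ
  ι-1 = refl

  toℚᵘ-ι : ∀ i → toℚᵘ (ι i) ℚᵘ.≃ mkℚᵘ i 0
  toℚᵘ-ι i = ℚ.toℚᵘ-fromℚᵘ (mkℚᵘ i 0)

  ι-+ : ∀ i j → ι (i ℤ.+ j) ≡ ι i + ι j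
  ι-+ i j = ℚ.toℚᵘ-injective (ℚᵘ.≃-trans (toℚᵘ-ι (i ℤ.+ j)) (ℚᵘ.≃-trans
    (*≡* (expand i j))
    (ℚᵘ.≃-sym (ℚᵘ.≃-trans (ℚ.toℚᵘ-homo-+ (ι i) (ι j)) (ℚᵘ.+-cong (toℚᵘ-ι i) (toℚᵘ-ι j))))))
    where
    expand : ∀ i j → (i ℤ.+ j) ℤ.* 1ℤ ≡ (i ℤ.* 1ℤ ℤ.+ j ℤ.* 1ℤ) ℤ.* 1ℤ
    expand = ℤRing.solve-∀

  ι-* : ∀ i j → ι (i ℤ.* j) ≡ ι i * ι j
  ι-* i j = ℚ.toℚᵘ-injective (ℚᵘ.≃-trans (toℚᵘ-ι (i ℤ.* j)) (ℚᵘ.≃-trans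
    (*≡* refl)
    (ℚᵘ.≃-sym (ℚᵘ.≃-trans (ℚ.toℚᵘ-homo-* (ι i) (ι j)) (ℚᵘ.*-cong (toℚᵘ-ι i) (toℚᵘ-ι j))))))

  ι-neg : ∀ i → ι (ℤ.- i) ≡ - ι i
  ι-neg i = ℚ.toℚᵘ-injective (ℚᵘ.≃-trans (toℚᵘ-ι (ℤ.- i))
    (ℚᵘ.≃-sym (ℚᵘ.≃-trans (ℚ.toℚᵘ-homo‿- (ι i)) (ℚᵘ.-‿cong (toℚᵘ-ι i)))))

  ι-mono-< : ∀ {i j} → i ℤ.< j → ι i < ι j
  ι-mono-< {i} {j} i<j = ℚ.toℚᵘ-cancel-<
    (ℚᵘ.<-respʳ-≃ (ℚᵘ.≃-sym (toℚᵘ-ι j)) (ℚᵘ.<-respˡ-≃ (ℚᵘ.≃-sym (toℚᵘ-ι i))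
      (*<* (subst₂ ℤ._<_ (sym (ℤ.*-identityʳ i)) (sym (ℤ.*-identityʳ j)) i<j))))

ι-- : ∀ i j → ι (i ℤ.- j) ≡ ι i - ι j
ι-- i j = trans (ι-+ i (ℤ.- j)) (cong (λ z → ι i + z) (ι-neg j))

ι-mono-≤ : ∀ {i j} → i ℤ.≤ j → ι i ≤ ι j
ι-mono-≤ {i} {j} i≤j with i ℤ.≟ j
... | yes refl = ℚ.≤-refl
... | no i≢j = ℚ.<⇒≤ (ι-mono-< (ℤ.≤∧≢⇒< i≤j i≢j))

ι-injective : ∀ {i j} → ι i ≡ ι j → i ≡ j
ι-injective {i} {j} eq with ℤ.<-cmp i j
... | tri< i<j _ _ = contradiction eq (ℚ.<⇒≢ (ι-mono-< i<j))
... | tri≈ _ i≡j _ = i≡j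
... | tri> _ _ j<i = contradiction (sym eq) (ℚ.<⇒≢ (ι-mono-< j<i))

0≤* : ∀ {p q} → 0ℚ ≤ p → 0ℚ ≤ q → 0ℚ ≤ p * q
0≤* {p} {q} 0≤p 0≤q = ℚ.nonNegative⁻¹ (p * q)
  {{ℚ.nonNeg*nonNeg⇒nonNeg p {{nonNegative 0≤p}} q {{nonNegative 0≤q}}}}

0<* : ∀ {p q} → 0ℚ < p → 0ℚ < q → 0ℚ < p * q
0<* {p} {q} 0<p 0<q = ℚ.positive⁻¹ (p * q)
  {{ℚ.pos*pos⇒pos p {{positive 0<p}} q {{positive 0<q}}}}

0≤+ : ∀ {p q} → 0ℚ ≤ p → 0ℚ ≤ q → 0ℚ ≤ p + q
0≤+ = ℚ.+-mono-≤

*-cancelˡ-0 : ∀ {p q} → p ≢ 0ℚ → p * q ≡ 0ℚ → q ≡ 0ℚ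
*-cancelˡ-0 {p} {q} p≢0 pq≡0 = begin
  q              ≡⟨ sym (ℚ.*-identityˡ q) ⟩
  1ℚ * q         ≡⟨ cong (_* q) (sym (ℚ.*-inverseˡ p)) ⟩
  1/ p * p * q   ≡⟨ ℚ.*-assoc (1/ p) p q ⟩
  1/ p * (p * q) ≡⟨ cong (1/ p *_) pq≡0 ⟩
  1/ p * 0ℚ      ≡⟨ ℚ.*-zeroʳ (1/ p) ⟩
  0ℚ             ∎
  where
  open ≡-Reasoning
  instance
    _ : NonZero p
    _ = ≢-nonZero p≢0

≤-from-0≤ : ∀ {p q} → 0ℚ ≤ q - p → p ≤ q
≤-from-0≤ {p} {q} h = subst₂ _≤_ (ℚ.+-identityˡ p) (e p q) (ℚ.+-monoˡ-≤ p h)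
  where
  e : ∀ p q → q - p + p ≡ q
  e = solve-∀ ℚ-ring

0≤-from-≤ : ∀ {p q} → p ≤ q → 0ℚ ≤ q - p
0≤-from-≤ {p} {q} h = subst (_≤ q - p) (ℚ.+-inverseʳ p) (ℚ.+-monoˡ-≤ (- p) h)

0<-neg : ∀ {p} → p < 0ℚ → 0ℚ < - p
0<-neg = ℚ.neg-antimono-<

<⇒≱ : ∀ {p q} → p < q → ¬ q ≤ p
<⇒≱ p<q q≤p = ℚ.<-irrefl refl (ℚ.<-≤-trans p<q q≤p)

-- Supporting hyperplanes and configurations in general position

dot-lin : ∀ {d} c c′ (a a′ x : Point d) →
  dot (λ j → c * a j + c′ * a′ j) x ≡ c * dot a x + c′ * dot a′ x
dot-lin {zero} c c′ a a′ x = e c c′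
  where
  e : ∀ c c′ → 0ℚ ≡ c * 0ℚ + c′ * 0ℚ
  e = solve-∀ ℚ-ring
dot-lin {suc d} c c′ a a′ x
  rewrite dot-lin c c′ (a ∘ suc) (a′ ∘ suc) (x ∘ suc) = e c c′ (a zero) (a′ zero) (x zero) _ _
  where
  e : ∀ c c′ a a′ x u u′ → (c * a + c′ * a′) * x + (c * u + c′ * u′) ≡ c * (a * x + u) + c′ * (a′ * x + u′)
  e = solve-∀ ℚ-ring

dot-*ʳ : ∀ {d} c (a x : Point d) → dot a (λ j → c * x j) ≡ c * dot a x
dot-*ʳ {zero} c a x = sym (ℚ.*-zeroʳ c)
dot-*ʳ {suc d} c a x rewrite dot-*ʳ c (a ∘ suc) (x ∘ suc) = e c (a zero) (x zero) _
  where
  e : ∀ c a x u → a * (c * x) + c * u ≡ c * (a * x + u)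
  e = solve-∀ ℚ-ring

dot-zeroˡ : ∀ {d} (a x : Point d) → (∀ j → a j ≡ 0ℚ) → dot a x ≡ 0ℚ
dot-zeroˡ {zero} a x a≡0 = refl
dot-zeroˡ {suc d} a x a≡0 rewrite a≡0 zero | dot-zeroˡ (a ∘ suc) (x ∘ suc) (a≡0 ∘ suc) = e (x zero)
  where
  e : ∀ x → 0ℚ * x + 0ℚ ≡ 0ℚ
  e = solve-∀ ℚ-ring

dot-zeroʳ : ∀ {d} (a x : Point d) → (∀ j → x j ≡ 0ℚ) → dot a x ≡ 0ℚ
dot-zeroʳ {zero} a x x≡0 = refl
dot-zeroʳ {suc d} a x x≡0 rewrite x≡0 zero | dot-zeroʳ (a ∘ suc) (x ∘ suc) (x≡0 ∘ suc) = e (a zero)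
  where
  e : ∀ x → x * 0ℚ + 0ℚ ≡ 0ℚ
  e = solve-∀ ℚ-ring

dot-comm : ∀ {d} (a x : Point d) → dot a x ≡ dot x a
dot-comm {zero} a x = refl
dot-comm {suc d} a x = cong₂ _+_ (ℚ.*-comm (a zero) (x zero)) (dot-comm (a ∘ suc) (x ∘ suc))

nonzero? : ∀ {d} (a : Point d) → Dec (∃ λ j → a j ≢ 0ℚ)
nonzero? a = Fin.any? (λ j → ¬? (a j ℚ.≟ 0ℚ))

all-zero : ∀ {d} {a : Point d} → ¬ (∃ λ j → a j ≢ 0ℚ) → ∀ j → a j ≡ 0ℚ
all-zero {a = a} ¬∃ j = decidable-stable (a j ℚ.≟ 0ℚ) λ aj≢0 → ¬∃ (j , aj≢0)

-- Gaussian elimination, one column per step: a row of F with nonzero first entry serves as pivot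
-- and leaves F, so the equations stay fewer than the unknowns. Rows are cross-multiplied instead of
-- divided.
kernel : ∀ {n} m (r : Fin n → Point m) (F : Subset n) → ∣ F ∣ ℕ.< m →
  ∃ λ x → (∃ λ j → x j ≢ 0ℚ) × (∀ i → i ∈ F → dot (r i) x ≡ 0ℚ)
kernel (suc m) r F F<m with Fin.any? (λ i → (i ∈? F) ×-dec ¬? (r i zero ℚ.≟ 0ℚ))
... | no ¬pivot = e₀ , (zero , λ ()) , λ i i∈F →
  trans (cong₂ _+_ (ℚ.*-identityʳ (r i zero)) (dot-zeroʳ (r i ∘ suc) (e₀ ∘ suc) (λ _ → refl)))
    (trans (ℚ.+-identityʳ (r i zero))
      (decidable-stable (r i zero ℚ.≟ 0ℚ) λ ri≢0 → ¬pivot (i , i∈F , ri≢0)))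
  where
  e₀ : Point (suc m)
  e₀ zero = 1ℚ
  e₀ (suc _) = 0ℚ
... | yes (p , p∈F , ρ≢0) = x , x≢0 , solves
  where
  ρ = r p zero
  reduced : _ → Point m
  reduced i j = ρ * r i (suc j) + (- r i zero) * r p (suc j)
  ih = kernel m reduced (F ∖ p) (ℕ.≤-trans (x∈p⇒∣p-x∣<∣p∣ p∈F) (ℕ.≤-pred F<m))
  y = proj₁ ih
  u = dot (r p ∘ suc) y
  x : Point (suc m)
  -- Back substitution: with tail ρ y, row p reads ρ x₀ + ρ u = 0.
  x zero = - u
  x (suc j) = ρ * y j
  x≢0 : ∃ λ j → x j ≢ 0ℚ
  x≢0 with proj₁ (proj₂ ih)
  ... | j , yj≢0 = suc j , λ xj≡0 → yj≢0 (*-cancelˡ-0 ρ≢0 xj≡0)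
  e₁ : ∀ ρ u → ρ * (- u) + ρ * u ≡ 0ℚ
  e₁ = solve-∀ ℚ-ring
  e₂ : ∀ ρ s u w → s * (- u) + ρ * w ≡ ρ * w + (- s) * u
  e₂ = solve-∀ ℚ-ring
  solves : ∀ i → i ∈ F → dot (r i) x ≡ 0ℚ
  solves i i∈F with i Fin.≟ p
  ... | yes refl = trans (cong (λ z → ρ * (- u) + z) (dot-*ʳ ρ (r p ∘ suc) y)) (e₁ ρ u)
  ... | no i≢p = begin
    r i zero * (- u) + dot (r i ∘ suc) (λ j → ρ * y j)
      ≡⟨ cong (λ z → r i zero * (- u) + z) (dot-*ʳ ρ (r i ∘ suc) y) ⟩
    r i zero * (- u) + ρ * dot (r i ∘ suc) y
      ≡⟨ e₂ ρ (r i zero) u _ ⟩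
    ρ * dot (r i ∘ suc) y + (- r i zero) * u
      ≡⟨ sym (dot-lin ρ (- r i zero) (r i ∘ suc) (r p ∘ suc) y) ⟩
    dot (reduced i) y
      ≡⟨ proj₂ (proj₂ ih) i (x∈p∧x≢y⇒x∈p-y i∈F i≢p) ⟩
    0ℚ ∎
    where open ≡-Reasoning

-- Ratio test: q minimises f / (- g) over the points where g is negative, so f + λ g with λ = f q /
-- (- g q) is the last nonnegative member of the pencil. It is multiplied by - g q to avoid
-- division.
rotate : ∀ {n} (f g : Fin n → ℚ) → (∀ i → 0ℚ ≤ f i) → (∃ λ i → g i < 0ℚ) →
  ∃ λ q → g q < 0ℚ × (∀ i → 0ℚ ≤ (- g q) * f i + f q * g i)
rotate {suc n} f g f≥0 (i , gi<0) with Fin.any? (λ i → g (suc i) ℚ.<? 0ℚ)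
... | no ¬neg = first i gi<0
  where
  e : ∀ f g → (- g) * f + f * g ≡ 0ℚ
  e = solve-∀ ℚ-ring
  first : ∀ i → g i < 0ℚ → _
  first (suc i) gi<0 = contradiction (i , gi<0) ¬neg
  first zero g0<0 = zero , g0<0 , λ where
    zero → ℚ.≤-reflexive (sym (e (f zero) (g zero)))
    (suc i) → 0≤+ (0≤* (ℚ.<⇒≤ (0<-neg g0<0)) (f≥0 (suc i)))
                  (0≤* (f≥0 zero) (ℚ.≮⇒≥ λ gi<0 → ¬neg (i , gi<0)))
... | yes (i′ , gi′<0) with rotate (f ∘ suc) (g ∘ suc) (f≥0 ∘ suc) (i′ , gi′<0)
... | q , gq<0 , h≥0 with 0ℚ ℚ.≤? (- g (suc q)) * f zero + f (suc q) * g zero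
... | yes h0≥0 = suc q , gq<0 , λ where
    zero → h0≥0
    (suc i) → h≥0 i
... | no h0≱0 = zero , g0<0 , first
  where
  -gq>0 = 0<-neg gq<0
  X<0 = ℚ.≰⇒> h0≱0
  g0<0 : g zero < 0ℚ
  g0<0 with g zero ℚ.<? 0ℚ
  ... | yes g0<0 = g0<0
  ... | no g0≮0 = contradiction
    (0≤+ (0≤* (ℚ.<⇒≤ -gq>0) (f≥0 zero)) (0≤* (f≥0 (suc q)) (ℚ.≮⇒≥ g0≮0))) h0≱0
  e₁ : ∀ f g → (- g) * f + f * g ≡ 0ℚ
  e₁ = solve-∀ ℚ-ring
  -- When index zero replaces q as the minimiser, the new inequality at i, times - g q, combines the
  -- old inequality at i with its failure at zero.
  e₂ : ∀ f₀ g₀ fq gq fi gi → (- g₀) * ((- gq) * fi + fq * gi) + (- gi) * (- ((- gq) * f₀ + fq * g₀))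
    ≡ (- gq) * ((- g₀) * fi + f₀ * gi)
  e₂ = solve-∀ ℚ-ring
  first : ∀ i → 0ℚ ≤ (- g zero) * f i + f zero * g i
  first zero = ℚ.≤-reflexive (sym (e₁ (f zero) (g zero)))
  first (suc i) with g (suc i) ℚ.<? 0ℚ
  ... | no gi≮0 = 0≤+ (0≤* (ℚ.<⇒≤ (0<-neg g0<0)) (f≥0 (suc i))) (0≤* (f≥0 zero) (ℚ.≮⇒≥ gi≮0))
  ... | yes gi<0 = ℚ.*-cancelˡ-≤-pos (- g (suc q)) {{positive -gq>0}}
    (subst₂ _≤_ (sym (ℚ.*-zeroʳ (- g (suc q))))
      (e₂ (f zero) (g zero) (f (suc q)) (g (suc q)) (f (suc i)) (g (suc i)))
      (0≤+ (0≤* (ℚ.<⇒≤ (0<-neg g0<0)) (h≥0 i))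
           (0≤* (ℚ.<⇒≤ (0<-neg gi<0)) (ℚ.<⇒≤ (0<-neg X<0)))))

-- Divided by f, a member of the pencil is D + fᵤ g / f, which increases with g / f. If it is zero
-- at i, it is negative at any j with a smaller quotient.
pencil-order : ∀ {D fᵤ fᵢ fⱼ gᵢ gⱼ} → 0ℚ < D → 0ℚ ≤ fᵤ → 0ℚ < fᵢ → gⱼ * fᵢ < gᵢ * fⱼ →
  D * fᵢ + fᵤ * gᵢ ≡ 0ℚ → ¬ 0ℚ ≤ D * fⱼ + fᵤ * gⱼ
pencil-order {D} {fᵤ} {fᵢ} {fⱼ} {gᵢ} {gⱼ} D>0 fᵤ≥0 fᵢ>0 sooner hᵢ≡0 hⱼ≥0 = <⇒≱ below (0≤* (ℚ.<⇒≤ fᵢ>0) hⱼ≥0)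
  where
  e₀ : ∀ x y → x ≡ x + 0ℚ * y
  e₀ = solve-∀ ℚ-ring
  fᵤ≢0 : fᵤ ≢ 0ℚ
  fᵤ≢0 refl = ℚ.<⇒≢ (0<* D>0 fᵢ>0) (sym (trans (e₀ (D * fᵢ) gᵢ) hᵢ≡0))
  fᵤ>0 : 0ℚ < fᵤ
  fᵤ>0 with ℚ.<-cmp 0ℚ fᵤ
  ... | tri< 0<fᵤ _ _ = 0<fᵤ
  ... | tri≈ _ 0≡fᵤ _ = contradiction (sym 0≡fᵤ) fᵤ≢0
  ... | tri> _ _ fᵤ<0 = contradiction fᵤ≥0 (<⇒≱ fᵤ<0)
  e₁ : ∀ D fᵢ fⱼ fᵤ gⱼ → D * fᵢ * fⱼ + fᵤ * (gⱼ * fᵢ) ≡ fᵢ * (D * fⱼ + fᵤ * gⱼ)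
  e₁ = solve-∀ ℚ-ring
  e₂ : ∀ D fᵢ fⱼ fᵤ gᵢ → D * fᵢ * fⱼ + fᵤ * (gᵢ * fⱼ) ≡ fⱼ * (D * fᵢ + fᵤ * gᵢ)
  e₂ = solve-∀ ℚ-ring
  below : fᵢ * (D * fⱼ + fᵤ * gⱼ) < 0ℚ
  below = subst₂ _<_ (e₁ D fᵢ fⱼ fᵤ gⱼ)
    (trans (e₂ D fᵢ fⱼ fᵤ gᵢ) (trans (cong (fⱼ *_) hᵢ≡0) (ℚ.*-zeroʳ fⱼ)))
    (ℚ.+-monoʳ-< (D * fᵢ * fⱼ) (ℚ.*-monoʳ-<-pos fᵤ {{positive fᵤ>0}} sooner))

-- The sign makes φ ≥ 0 the valid inequality a · x ≤ b, so the zeros of such a φ form a face.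
Affine : ∀ {d n} → Config d n → (Fin n → ℚ) → Set
Affine {d} v φ = Σ (Point d) λ a → Σ ℚ λ b → ∀ i → φ i ≡ b - dot a (v i)

affine-lin : ∀ {d n} {v : Config d n} {φ ψ} c c′ → Affine v φ → Affine v ψ →
  Affine v (λ i → c * φ i + c′ * ψ i)
affine-lin {v = v} c c′ (a , b , φ≡) (a′ , b′ , ψ≡) =
  (λ j → c * a j + c′ * a′ j) , c * b + c′ * b′ , λ i →
    trans (cong₂ (λ x y → c * x + c′ * y) (φ≡ i) (ψ≡ i))
      (trans (e c c′ b b′ (dot a (v i)) (dot a′ (v i)))
        (cong (λ z → c * b + c′ * b′ - z) (sym (dot-lin c c′ a a′ (v i)))))
  where
  e : ∀ c c′ b b′ x x′ → c * (b - x) + c′ * (b′ - x′) ≡ (c * b + c′ * b′) - (c * x + c′ * x′)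
  e = solve-∀ ℚ-ring

affine-cong : ∀ {d n} {v : Config d n} {φ ψ : Fin n → ℚ} → (∀ i → φ i ≡ ψ i) → Affine v φ → Affine v ψ
affine-cong φ≡ψ (a , b , φ≡) = a , b , λ i → trans (sym (φ≡ψ i)) (φ≡ i)

affine-* : ∀ {d n} {v : Config d n} {φ} c → Affine v φ → Affine v (λ i → c * φ i)
affine-* {v = v} {φ} c φ-affine = affine-cong {v = v} (λ i → e c (φ i)) (affine-lin {v = v} {φ} {φ} c 0ℚ φ-affine φ-affine)
  where
  e : ∀ c x → c * x + 0ℚ * x ≡ c * x
  e = solve-∀ ℚ-ring

affine-shift : ∀ {d n} {v : Config d n} {φ} c → Affine v φ → Affine v (λ i → φ i + c)
affine-shift {v = v} c (a , b , φ≡) = a , b + c , λ i → trans (cong (λ z → z + c) (φ≡ i)) (e b c (dot a (v i)))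
  where
  e : ∀ b c x → b - x + c ≡ b + c - x
  e = solve-∀ ℚ-ring

zeros : ∀ {n} → (Fin n → ℚ) → Subset n
zeros φ = tabulate λ i → does (φ i ℚ.≟ 0ℚ)

∈-zeros⁺ : ∀ {n} (φ : Fin n → ℚ) {i} → φ i ≡ 0ℚ → i ∈ zeros φ
∈-zeros⁺ φ {i} φi≡0 = lookup⇒[]= i (zeros φ)
  (trans (lookup∘tabulate _ i) (dec-true (φ i ℚ.≟ 0ℚ) φi≡0))

∈-zeros⁻ : ∀ {n} (φ : Fin n → ℚ) {i} → i ∈ zeros φ → φ i ≡ 0ℚ
∈-zeros⁻ φ {i} i∈ with φ i ℚ.≟ 0ℚ | trans (sym (lookup∘tabulate (λ i → does (φ i ℚ.≟ 0ℚ)) i)) ([]=⇒lookup i∈)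
... | yes φi≡0 | _ = φi≡0

b-x≡0⇒x≡b : ∀ {b x} → b - x ≡ 0ℚ → x ≡ b
b-x≡0⇒x≡b {b} {x} eq = trans (e b x) (trans (cong (λ z → b - z) eq) (ℚ.+-identityʳ b))
  where
  e : ∀ b x → x ≡ b - (b - x)
  e = solve-∀ ℚ-ring

-- The points q and p exclude a = 0: a constant φ that vanishes at q would vanish at p as well.
affine-properFace : ∀ {d n} {v : Config d n} {φ F} → Affine v φ → (∀ i → 0ℚ ≤ φ i) →
  (∀ i → φ i ≡ 0ℚ ⇔ i ∈ F) → (∃ λ q → q ∈ F) → (∃ λ p → p ∉ F) → ProperFace v F
affine-properFace {v = v} {φ} {F} (a , b , φ≡) φ≥0 φ-zero (q , q∈F) (p , p∉F) =
  a , b , a≢0 ,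
  (λ i → ≤-from-0≤ (subst (0ℚ ≤_) (φ≡ i) (φ≥0 i))) ,
  λ i → mk⇔
    (λ eq → Equivalence.to (φ-zero i) (trans (φ≡ i) (trans (cong (λ z → b - z) eq) (ℚ.+-inverseʳ b))))
    (λ i∈F → b-x≡0⇒x≡b (trans (sym (φ≡ i)) (Equivalence.from (φ-zero i) i∈F)))
  where
  a≢0 : ∃ λ j → a j ≢ 0ℚ
  a≢0 with nonzero? a
  ... | yes a≢0 = a≢0
  ... | no a≡0 = contradiction (Equivalence.to (φ-zero p)
      (trans (const p) (trans (sym (const q)) (Equivalence.from (φ-zero q) q∈F)))) p∉F
    where
    const : ∀ i → φ i ≡ b - 0ℚ
    const i = trans (φ≡ i) (cong (λ z → b - z) (dot-zeroˡ a (v i) (all-zero a≡0)))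

zeros-properFace : ∀ {d n} {v : Config d n} (φ : Fin n → ℚ) → Affine v φ → (∀ i → 0ℚ ≤ φ i) →
  (∃ λ q → φ q ≡ 0ℚ) → (∃ λ p → φ p ≢ 0ℚ) → ProperFace v (zeros φ)
zeros-properFace {v = v} φ φ-affine φ≥0 (q , φq≡0) (p , φp≢0) =
  affine-properFace {v = v} {φ} φ-affine φ≥0 (λ i → mk⇔ (∈-zeros⁺ φ) (∈-zeros⁻ φ))
    (q , ∈-zeros⁺ φ φq≡0) (p , λ p∈ → φp≢0 (∈-zeros⁻ φ p∈))

missing : ∀ {n} (F : Subset n) → ∣ F ∣ ℕ.< n → ∃ λ p → p ∉ F
missing (outside ∷ F) _ = zero , λ ()
missing (inside ∷ F) (s≤s F<n) with missing F F<n
... | p , p∉F = suc p , λ p∈ → p∉F (drop-there p∈)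

-- Facets of configurations in general position

GeneralPosition : ∀ {d n} → Config d n → Set
GeneralPosition {d} {n} v = ∀ a b → (∃ λ j → a j ≢ 0ℚ) → ∀ (F : Subset n) →
  (∀ i → i ∈ F → dot a (v i) ≡ b) → ∣ F ∣ ℕ.≤ d

module _ {d n} {v : Config d n} (gp : GeneralPosition v) (d<n : d ℕ.< n) where

  generic-fullDimensional : FullDimensional v
  generic-fullDimensional a b eq with nonzero? a
  ... | no a≡0 = all-zero a≡0
  ... | yes a≢0 = contradiction (gp a b a≢0 ⊤ (λ i _ → eq i))
    (ℕ.<⇒≱ (subst (d ℕ.<_) (sym (∣⊤∣≡n n)) d<n))

  properFace-size : ∀ {F} → ProperFace v F → ∣ F ∣ ℕ.≤ d
  properFace-size {F} (a , b , a≢0 , _ , on) = gp a b a≢0 F λ i → Equivalence.from (on i)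

  -- General position caps every proper face at d points, so a face that has d of them cannot grow.
  large-properFace-facet : ∀ {F} → ProperFace v F → d ℕ.≤ ∣ F ∣ → Facet v F
  large-properFace-facet {F} face d≤F = face , λ G G-face F⊆G {x} x∈G →
    decidable-stable (x ∈? F) λ x∉F →
      ℕ.<⇒≱ (p⊂q⇒∣p∣<∣q∣ (F⊆G , x , x∈G , x∉F)) (ℕ.≤-trans (properFace-size G-face) d≤F)

  -- If a maximal face F had fewer than d points, a hyperplane would still pass through F and some p
  -- outside F. Rotating the supporting hyperplane about the intersection of the two until it
  -- reaches a point q gives a proper face that contains F and q, against maximality.
  facet-size : ∀ {F} → Facet v F → ∣ F ∣ ≡ d
  facet-size {F} (face@(a , b , a≢0 , below , on) , maximal) =
    ℕ.≤-antisym (properFace-size face) (ℕ.≮⇒≥ small-impossible)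
    where
    small-impossible : ¬ ∣ F ∣ ℕ.< d
    small-impossible F<d = contradiction (g-zero q (maximal G G-face F⊆G q∈G))
                                         (ℚ.<⇒≢ gq<0)
      where
      f : Fin n → ℚ
      f i = b - dot a (v i)
      f≥0 : ∀ i → 0ℚ ≤ f i
      f≥0 i = 0≤-from-≤ (below i)
      f-zero : ∀ i → i ∈ F → f i ≡ 0ℚ
      f-zero i i∈F = trans (cong (λ z → b - z) (Equivalence.from (on i) i∈F)) (ℚ.+-inverseʳ b)
      p = proj₁ (missing F (ℕ.<-trans F<d d<n))
      p∉F = proj₂ (missing F (ℕ.<-trans F<d d<n))
      -- Paired with x = (b₁, a₁), row i is a₁ · v i - b₁, so the kernel consists of the hyperplanes
      -- through the given points.
      row : Fin n → Point (suc d)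
      row i zero = - 1ℚ
      row i (suc j) = v i j
      rows : Fin (suc n) → Point (suc d)
      rows zero = row p
      rows (suc i) = row i
      solution = kernel (suc d) rows (inside ∷ F) (s≤s F<d)
      x = proj₁ solution
      a₁ : Point d
      a₁ = x ∘ suc
      on-row : ∀ i → dot (row i) x ≡ 0ℚ → dot a₁ (v i) ≡ x zero
      on-row i eq = b-x≡0⇒x≡b (trans (e′ (x zero) (dot a₁ (v i)))
        (cong -_ (trans (cong (λ z → (- 1ℚ) * x zero + z) (dot-comm a₁ (v i))) eq)))
        where
        e′ : ∀ x y → x - y ≡ - ((- 1ℚ) * x + y)
        e′ = solve-∀ ℚ-ring
      a₁≢0 : ∃ λ j → a₁ j ≢ 0ℚ
      a₁≢0 with nonzero? a₁ | proj₁ (proj₂ solution)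
      ... | yes a₁≢0 | _ = a₁≢0
      ... | no a₁≡0 | suc j , xj≢0 = j , xj≢0
      ... | no a₁≡0 | zero , x0≢0 = contradiction
        (trans (sym (on-row p (proj₂ (proj₂ solution) zero here))) (dot-zeroˡ a₁ (v p) (all-zero a₁≡0))) x0≢0
      k : Fin n → ℚ
      k i = x zero - dot a₁ (v i)
      k-zero : ∀ i → dot (row i) x ≡ 0ℚ → k i ≡ 0ℚ
      k-zero i eq = trans (cong (λ z → x zero - z) (on-row i eq)) (ℚ.+-inverseʳ (x zero))
      -- Some sign of k is negative somewhere; otherwise all points would lie on one hyperplane.
      oriented : ∃ λ s → ∃ λ i → s * k i < 0ℚ
      oriented with Fin.any? (λ i → k i ℚ.<? 0ℚ) | Fin.any? (λ i → 0ℚ ℚ.<? k i)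
      ... | yes (i , ki<0) | _ = 1ℚ , i , subst (_< 0ℚ) (sym (ℚ.*-identityˡ (k i))) ki<0
      ... | no _ | yes (i , ki>0) = - 1ℚ , i , subst (_< 0ℚ) (e″ (k i)) (ℚ.neg-antimono-< ki>0)
        where
        e″ : ∀ x → - x ≡ (- 1ℚ) * x
        e″ = solve-∀ ℚ-ring
      ... | no ¬neg | no ¬pos = contradiction (generic-fullDimensional a₁ (x zero) k≡0 (proj₁ a₁≢0)) (proj₂ a₁≢0)
        where
        k≡0 : ∀ i → dot a₁ (v i) ≡ x zero
        k≡0 i = b-x≡0⇒x≡b (ℚ.≤-antisym (ℚ.≮⇒≥ λ ki>0 → ¬pos (i , ki>0)) (ℚ.≮⇒≥ λ ki<0 → ¬neg (i , ki<0)))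
      s = proj₁ oriented
      g : Fin n → ℚ
      g i = s * k i
      g-zero : ∀ i → i ∈ F → g i ≡ 0ℚ
      g-zero i i∈F = trans (cong (s *_) (k-zero i (proj₂ (proj₂ solution) (suc i) (there i∈F)))) (ℚ.*-zeroʳ s)
      gp≡0 : g p ≡ 0ℚ
      gp≡0 = trans (cong (s *_) (k-zero p (proj₂ (proj₂ solution) zero here))) (ℚ.*-zeroʳ s)
      rotation = rotate f g f≥0 (proj₂ oriented)
      q = proj₁ rotation
      gq<0 = proj₁ (proj₂ rotation)
      h : Fin n → ℚ
      h i = (- g q) * f i + f q * g i
      h-affine : Affine v h
      h-affine = affine-lin {v = v} {f} {g} (- g q) (f q) (a , b , λ _ → refl)
        (affine-* {v = v} {k} s (a₁ , x zero , λ _ → refl))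
      G = zeros h
      hq≡0 : h q ≡ 0ℚ
      hq≡0 = e₁ (f q) (g q)
        where
        e₁ : ∀ f g → (- g) * f + f * g ≡ 0ℚ
        e₁ = solve-∀ ℚ-ring
      q∈G = ∈-zeros⁺ h hq≡0
      fp≢0 : f p ≢ 0ℚ
      fp≢0 fp≡0 = p∉F (Equivalence.to (on p) (b-x≡0⇒x≡b fp≡0))
      -- Since g p = 0 and f p is not 0, the rotation never reaches p, and G is proper.
      hp≢0 : h p ≢ 0ℚ
      hp≢0 hp≡0 = fp≢0 (*-cancelˡ-0 (λ eq → ℚ.<⇒≢ (0<-neg gq<0) (sym eq))
        (trans (e₂ (f p) (f q) (g q)) (trans (cong (λ z → (- g q) * f p + f q * z) (sym gp≡0)) hp≡0)))
        where
        e₂ : ∀ f f′ g → (- g) * f ≡ (- g) * f + f′ * 0ℚ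
        e₂ = solve-∀ ℚ-ring
      G-face = zeros-properFace {v = v} h h-affine (proj₂ (proj₂ rotation)) (q , hq≡0) (p , hp≢0)
      F⊆G : F ⊆ G
      F⊆G {i} i∈F = ∈-zeros⁺ h (trans (cong₂ (λ y z → (- g q) * y + f q * z) (f-zero i i∈F)
        (g-zero i i∈F)) (e₃ (g q) (f q)))
        where
        e₃ : ∀ g f → (- g) * 0ℚ + f * 0ℚ ≡ 0ℚ
        e₃ = solve-∀ ℚ-ring

-- Polynomials in Horner form

-- Degree at most m, with coefficient c (possibly zero) at t^m.
data Lead : ℕ → ℚ → (ℚ → ℚ) → Set where
  const  : ∀ {c φ} → (∀ t → φ t ≡ c) → Lead 0 c φ
  horner : ∀ {m c φ ψ} p₀ → Lead m c ψ → (∀ t → φ t ≡ p₀ + t * ψ t) → Lead (suc m) c φ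

lead-cong : ∀ {m c φ ψ} → (∀ t → ψ t ≡ φ t) → Lead m c φ → Lead m c ψ
lead-cong eq (const φ≡) = const λ t → trans (eq t) (φ≡ t)
lead-cong eq (horner p₀ ψ φ≡) = horner p₀ ψ λ t → trans (eq t) (φ≡ t)

lead-* : ∀ {m c φ} α → Lead m c φ → Lead m (α * c) (λ t → α * φ t)
lead-* α (const φ≡) = const λ t → cong (α *_) (φ≡ t)
lead-* α (horner {ψ = ψ} p₀ l φ≡) = horner (α * p₀) (lead-* α l) λ t →
  trans (cong (α *_) (φ≡ t)) (e α p₀ t (ψ t))
  where
  e : ∀ α p t x → α * (p + t * x) ≡ α * p + t * (α * x)
  e = solve-∀ ℚ-ring

lead-+-lower : ∀ {m c c′ φ ψ} → Lead (suc m) c φ → Lead m c′ ψ → Lead (suc m) c (λ t → φ t + ψ t)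
lead-+-lower (horner {ψ = φ′} p₀ l φ≡) (const {c′} ψ≡) = horner (p₀ + c′) l λ t →
  trans (cong₂ _+_ (φ≡ t) (ψ≡ t)) (e p₀ c′ t (φ′ t))
  where
  e : ∀ p c t x → (p + t * x) + c ≡ p + c + t * x
  e = solve-∀ ℚ-ring
lead-+-lower (horner {ψ = φ′} p₀ l φ≡) (horner {ψ = ψ′} q₀ l′ ψ≡) =
  horner (p₀ + q₀) (lead-+-lower l l′) λ t → trans (cong₂ _+_ (φ≡ t) (ψ≡ t)) (e p₀ q₀ t (φ′ t) (ψ′ t))
  where
  e : ∀ p q t x y → (p + t * x) + (q + t * y) ≡ p + q + t * (x + y)
  e = solve-∀ ℚ-ring

lead-*-linear : ∀ {m c φ} α β → Lead m c φ → Lead (suc m) (α * c) (λ t → (α * t + β) * φ t)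
lead-*-linear {φ = φ} α β l = lead-cong (λ t → e₁ α β t (φ t))
  (lead-+-lower (horner 0ℚ (lead-* α l) (λ t → e₂ (t * (α * φ t)))) (lead-* β l))
  where
  e₁ : ∀ α β t x → (α * t + β) * x ≡ t * (α * x) + β * x
  e₁ = solve-∀ ℚ-ring
  e₂ : ∀ x → x ≡ 0ℚ + x
  e₂ = solve-∀ ℚ-ring

lead-suc : ∀ {m c φ} → Lead m c φ → Lead (suc m) 0ℚ φ
lead-suc (const {c} φ≡) = horner {ψ = λ _ → 0ℚ} c (const λ _ → refl) λ t → trans (φ≡ t) (e c t)
  where
  e : ∀ c t → c ≡ c + t * 0ℚ
  e = solve-∀ ℚ-ring
lead-suc (horner p₀ l φ≡) = horner p₀ (lead-suc l) φ≡

lead-raise : ∀ {m d c φ} → m ℕ.<′ d → Lead m c φ → Lead d 0ℚ φ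
lead-raise ℕ.<′-base l = lead-suc l
lead-raise (ℕ.<′-step m<d) l = lead-suc (lead-raise m<d l)

-- Synthetic division: the difference quotient of p₀ + t ψ at x is ψ plus x times that of ψ, and the
-- second summand has lower degree, so c survives.
lead-quotient : ∀ {m c φ} → Lead (suc m) c φ → ∀ x →
  ∃ λ χ → Lead m c χ × (∀ t → (t - x) * χ t ≡ φ t - φ x)
lead-quotient {zero} (horner {c = c} {ψ = ψ} p₀ (const ψ≡) φ≡) x =
  (λ _ → c) , const (λ _ → refl) , λ t →
    sym (trans (cong₂ _-_ (trans (φ≡ t) (cong (λ z → p₀ + t * z) (ψ≡ t)))
                          (trans (φ≡ x) (cong (λ z → p₀ + x * z) (ψ≡ x)))) (e p₀ t x c))
  where
  e : ∀ p t x c → (p + t * c) - (p + x * c) ≡ (t - x) * c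
  e = solve-∀ ℚ-ring
lead-quotient {suc m} (horner {ψ = ψ} p₀ l φ≡) x with lead-quotient l x
... | χ , χ-lead , χ≡ = (λ t → ψ t + x * χ t) , lead-+-lower l (lead-* x χ-lead) , λ t → begin
  (t - x) * (ψ t + x * χ t)                ≡⟨ e₁ t x (ψ t) (χ t) ⟩
  (t - x) * ψ t + x * ((t - x) * χ t)      ≡⟨ cong (λ z → (t - x) * ψ t + x * z) (χ≡ t) ⟩
  (t - x) * ψ t + x * (ψ t - ψ x)          ≡⟨ e₂ p₀ t x (ψ t) (ψ x) ⟩
  (p₀ + t * ψ t) - (p₀ + x * ψ x)          ≡⟨ sym (cong₂ _-_ (φ≡ t) (φ≡ x)) ⟩
  _ ∎
  where
  open ≡-Reasoning
  e₁ : ∀ t x y z → (t - x) * (y + x * z) ≡ (t - x) * y + x * ((t - x) * z)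
  e₁ = solve-∀ ℚ-ring
  e₂ : ∀ p t x y z → (t - x) * y + x * (y - z) ≡ (p + t * y) - (p + x * z)
  e₂ = solve-∀ ℚ-ring

infixr 8 _^_
_^_ : ℚ → ℕ → ℚ
x ^ zero = 1ℚ
x ^ suc m = x * x ^ m

powers : ∀ {m} → ℚ → Point m
powers t zero = 1ℚ
powers t (suc j) = t * powers t j

lead-coefficients : ∀ {m c φ} → Lead m c φ →
  ∃ λ (p : Point m) → ∀ t → φ t ≡ c * t ^ m + dot p (powers t)
lead-coefficients (const {c} φ≡) = (λ ()) , λ t → trans (φ≡ t) (e c)
  where
  e : ∀ c → c ≡ c * 1ℚ + 0ℚ
  e = solve-∀ ℚ-ring
lead-coefficients {suc m} {c} (horner {ψ = ψ} p₀ l φ≡) with lead-coefficients l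
... | p , ψ≡ = p′ , λ t → trans (φ≡ t) (trans (cong (λ z → p₀ + t * z) (ψ≡ t))
    (trans (e p₀ t c (t ^ m) (dot p (powers t))) (cong (λ z → c * t ^ suc m + (p₀ * 1ℚ + z)) (sym (dot-*ʳ t p (powers t))))))
  where
  p′ : Point (suc m)
  p′ zero = p₀
  p′ (suc j) = p j
  e : ∀ p t c x y → p + t * (c * x + y) ≡ c * (t * x) + (p * 1ℚ + t * y)
  e = solve-∀ ℚ-ring

coefficients-lead : ∀ m c (p : Point m) → Lead m c (λ t → c * t ^ m + dot p (powers t))
coefficients-lead zero c p = const λ t → e c
  where
  e : ∀ c → c * 1ℚ + 0ℚ ≡ c
  e = solve-∀ ℚ-ring
coefficients-lead (suc m) c p = horner (p zero) (coefficients-lead m c (p ∘ suc)) λ t →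
  trans (cong (λ z → c * t ^ suc m + (p zero * 1ℚ + z)) (dot-*ʳ t (p ∘ suc) (powers t)))
    (e (p zero) t c (t ^ m) (dot (p ∘ suc) (powers t)))
  where
  e : ∀ p t c x y → c * (t * x) + (p * 1ℚ + t * y) ≡ p + t * (c * x + y)
  e = solve-∀ ℚ-ring

-- The exact degree, for hyperplanes whose top coefficient is 0: which lower coefficient leads is
-- then unknown.
nonzero-lead : ∀ {m} (p : Point m) → (∃ λ j → p j ≢ 0ℚ) →
  ∃ λ l → l ℕ.< m × ∃ λ c → c ≢ 0ℚ × Lead l c (λ t → dot p (powers t))
nonzero-lead {suc m} p (i , pi≢0) with nonzero? (p ∘ suc)
... | no tail≡0 = 0 , s≤s z≤n , p zero , p0≢0 i pi≢0 , const λ t →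
  trans (cong (λ z → p zero * 1ℚ + z) (dot-zeroˡ (p ∘ suc) (λ j → t * powers t j) (all-zero tail≡0))) (e (p zero))
  where
  e : ∀ p → p * 1ℚ + 0ℚ ≡ p
  e = solve-∀ ℚ-ring
  p0≢0 : ∀ i → p i ≢ 0ℚ → p zero ≢ 0ℚ
  p0≢0 zero p0≢0 = p0≢0
  p0≢0 (suc j) pj≢0 = contradiction (j , pj≢0) tail≡0
... | yes tail≢0 with nonzero-lead (p ∘ suc) tail≢0
... | l , l<m , c , c≢0 , lead = suc l , s≤s l<m , c , c≢0 , horner (p zero) lead λ t →
  trans (cong (λ z → p zero * 1ℚ + z) (dot-*ʳ t (p ∘ suc) (powers t))) (cong (λ z → z + t * dot (p ∘ suc) (powers t)) (ℚ.*-identityʳ (p zero)))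

-- Iterated difference quotients: each one multiplies the values by a divisor of M and keeps c.
top-coefficient-multiple : ∀ {n m c φ} (M C : ℚ) (t : Fin n → ℚ) (F : Subset n) →
  (∀ {i j} → i ≢ j → ∃ λ y → ι y * (t i - t j) ≡ M) →
  Lead m c φ → m ℕ.< ∣ F ∣ → (∀ i → i ∈ F → ∃ λ z → φ (t i) ≡ C * ι z) →
  ∃ λ z → M ^ m * c ≡ C * ι z
top-coefficient-multiple M C t (outside ∷ F) differences lead m<F values =
  top-coefficient-multiple M C (t ∘ suc) F (λ i≢j → differences (i≢j ∘ Fin.suc-injective)) lead m<F
    (λ i i∈F → values (suc i) (there i∈F))
top-coefficient-multiple M C t (inside ∷ F) differences (const {c} φ≡) m<F values =
  proj₁ (values zero here) , trans (ℚ.*-identityˡ c) (trans (sym (φ≡ (t zero))) (proj₂ (values zero here)))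
top-coefficient-multiple {m = suc m} {c} {φ} M C t (inside ∷ F) differences lead (s≤s m<F) values =
  proj₁ ih , trans (e M (M ^ m) c) (proj₂ ih)
  where
  e : ∀ M X c → (M * X) * c ≡ X * (M * c)
  e = solve-∀ ℚ-ring
  χ = proj₁ (lead-quotient lead (t zero))
  χ-lead = proj₁ (proj₂ (lead-quotient lead (t zero)))
  χ≡ = proj₂ (proj₂ (lead-quotient lead (t zero)))
  quotient-value : ∀ {s y z z₀} → ι y * (s - t zero) ≡ M → φ s ≡ C * ι z → φ (t zero) ≡ C * ι z₀ →
    M * χ s ≡ C * ι (y ℤ.* (z ℤ.- z₀))
  quotient-value {s} {y} {z} {z₀} y≡ φs≡ φ₀≡ = begin
    M * χ s                              ≡⟨ cong (_* χ s) (sym y≡) ⟩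
    ι y * (s - t zero) * χ s             ≡⟨ ℚ.*-assoc (ι y) (s - t zero) (χ s) ⟩
    ι y * ((s - t zero) * χ s)           ≡⟨ cong (ι y *_) (χ≡ s) ⟩
    ι y * (φ s - φ (t zero))             ≡⟨ cong₂ (λ a b → ι y * (a - b)) φs≡ φ₀≡ ⟩
    ι y * (C * ι z - C * ι z₀)           ≡⟨ e′ (ι y) C (ι z) (ι z₀) ⟩
    C * (ι y * (ι z - ι z₀))             ≡⟨ cong (λ w → C * (ι y * w)) (sym (ι-- z z₀)) ⟩
    C * (ι y * ι (z ℤ.- z₀))             ≡⟨ cong (C *_) (sym (ι-* y (z ℤ.- z₀))) ⟩
    C * ι (y ℤ.* (z ℤ.- z₀))             ∎
    where
    open ≡-Reasoning
    e′ : ∀ y C a b → y * (C * a - C * b) ≡ C * (y * (a - b))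
    e′ = solve-∀ ℚ-ring
  ih = top-coefficient-multiple M C (t ∘ suc) F (λ i≢j → differences (i≢j ∘ Fin.suc-injective))
    (lead-* M χ-lead) m<F λ i i∈F →
      _ , quotient-value (proj₂ (differences {suc i} {zero} λ ())) (proj₂ (values (suc i) (there i∈F))) (proj₂ (values zero here))

-- Shifted moment curves

-- The moment curve with its top coordinate listed first and shifted there by N σ.
module Curve (d₀ : ℕ) {n} (t : Fin n → ℕ) (σ : Fin n → ℤ) (N : ℕ) where

  d = suc d₀

  T : Fin n → ℚ
  T i = ι (+ t i)

  shift : Fin n → ℚ
  shift i = ι (+ N ℤ.* σ i)

  v : Config d n
  v i zero = shift i + T i ^ d
  v i (suc j) = T i * powers (T i) j

  -- Polynomials of degree at most d are affine on the moment curve. Here the top coordinate is t ^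
  -- d plus the shift, so the affine function picks up c times the shift.
  lead-affine : ∀ {c φ} → Lead d c φ → Affine v (λ i → φ (T i) + c * shift i)
  lead-affine {c} {φ} lead with lead-coefficients lead
  ... | p , φ≡ = a , p zero , λ i → trans (cong (λ z → z + c * shift i) (φ≡ (T i)))
      (trans (e₁ c (T i ^ d) (p zero) (dot (p ∘ suc) (v i ∘ suc)) (shift i))
        (cong (λ z → p zero - ((- c) * v i zero + z)) (sym (trans
          (dot-lin (- 1ℚ) 0ℚ (p ∘ suc) (p ∘ suc) (v i ∘ suc)) (e₂ (dot (p ∘ suc) (v i ∘ suc)))))))
    where
    a : Point d
    a zero = - c
    -- This is - p, in the shape that `dot-lin` expects.
    a (suc j) = (- 1ℚ) * p (suc j) + 0ℚ * p (suc j)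
    e₁ : ∀ c x p y s → c * x + (p * 1ℚ + y) + c * s ≡ p - ((- c) * (s + x) + (- y))
    e₁ = solve-∀ ℚ-ring
    e₂ : ∀ y → (- 1ℚ) * y + 0ℚ * y ≡ - y
    e₂ = solve-∀ ℚ-ring

  module _ {M : ℕ} (M>0 : 0 ℕ.< M) (N>M^d : M ℕ.^ d ℕ.< N)
           (differences : ∀ {i j} → i ≢ j → ∃ λ y → y ℤ.* (+ t i ℤ.- + t j) ≡ + M) where

    T-differences : ∀ {i j} → i ≢ j → ∃ λ y → ι y * (T i - T j) ≡ ι (+ M)
    T-differences {i} {j} i≢j with differences i≢j
    ... | y , eq = y , trans (cong (ι y *_) (sym (ι-- (+ t i) (+ t j))))
                       (trans (sym (ι-* y (+ t i ℤ.- + t j))) (cong ι eq))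

    ι-^ : ∀ m → ι (+ M) ^ m ≡ ι (+ (M ℕ.^ m))
    ι-^ zero = sym ι-1
    ι-^ (suc m) = trans (cong (ι (+ M) *_) (ι-^ m))
      (trans (sym (ι-* (+ M) (+ (M ℕ.^ m)))) (cong ι (sym (ℤ.pos-* M (M ℕ.^ m)))))

    M^m>0 : ∀ m → 0 ℕ.< M ℕ.^ m
    M^m>0 m = ℕ.m^n>0 M {{ℕ.>-nonZero M>0}} m

    not-multiple : ∀ z → + (M ℕ.^ d) ≢ + N ℤ.* z
    not-multiple z eq = too-small ℤ.∣ z ∣ (trans (cong ℤ.∣_∣ eq) (ℤ.abs-* (+ N) z))
      where
      too-small : ∀ k → M ℕ.^ d ≢ N ℕ.* k
      too-small zero eq = ℕ.<⇒≢ (M^m>0 d) (sym (trans eq (ℕ.*-zeroʳ N)))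
      too-small (suc k) eq = ℕ.<⇒≱ N>M^d (subst (N ℕ.≤_) (sym eq) (ℕ.m≤m*n N (suc k)))

    -- Suppose more than d points lie on the hyperplane. If its top coefficient a₀ is nonzero, a
    -- polynomial with leading coefficient a₀ takes values in a₀ N ℤ at them, so d difference
    -- quotients give M ^ d = N z, which 0 < M ^ d < N excludes. If a₀ = 0, the shift drops out and
    -- a nonzero polynomial of degree below d has too many roots.
    generalPosition : GeneralPosition v
    generalPosition a b (j , aj≢0) F on = ℕ.≮⇒≥ λ d<F →
      top≡0-impossible d<F (decidable-stable (a zero ℚ.≟ 0ℚ) (top≢0-impossible d<F))
      where
      p : Point d
      p zero = - b
      p (suc j) = a (suc j)
      value : ∀ i → i ∈ F → a zero * T i ^ d + dot p (powers (T i)) ≡ a zero * (- shift i)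
      value i i∈F = trans
        (e₁ (a zero) (T i ^ d) b (dot (a ∘ suc) (v i ∘ suc)) (shift i))
        (trans (cong (λ z → z - b + a zero * (- shift i)) (on i i∈F)) (e₂ b _))
        where
        e₁ : ∀ c x b y s → c * x + ((- b) * 1ℚ + y) ≡ (c * (s + x) + y) - b + c * (- s)
        e₁ = solve-∀ ℚ-ring
        e₂ : ∀ b x → b - b + x ≡ x
        e₂ = solve-∀ ℚ-ring
      top≢0-impossible : d ℕ.< ∣ F ∣ → ¬ (a zero ≢ 0ℚ)
      top≢0-impossible d<F c≢0 = not-multiple (proj₁ multiple) (ι-injective (trans (sym (ι-^ d)) (trans
          (b-x≡0⇒x≡b (*-cancelˡ-0 c≢0 (trans (e (a zero) (ι (+ N)) (ι z) (ι (+ M) ^ d))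
            (trans (cong (λ w → a zero * ι (+ N) * ι z - w) (proj₂ multiple)) (ℚ.+-inverseʳ (a zero * ι (+ N) * ι z))))))
          (sym (ι-* (+ N) z)))))
        where
        open ≡-Reasoning
        e : ∀ c N z X → c * (N * z - X) ≡ c * N * z - X * c
        e = solve-∀ ℚ-ring
        multiple = top-coefficient-multiple (ι (+ M)) (a zero * ι (+ N)) T F T-differences
          (coefficients-lead d (a zero) p) d<F (λ i i∈F → ℤ.- σ i , (begin
            a zero * T i ^ d + dot p (powers (T i))  ≡⟨ value i i∈F ⟩
            a zero * (- ι (+ N ℤ.* σ i))             ≡⟨ cong (a zero *_) (sym (ι-neg (+ N ℤ.* σ i))) ⟩
            a zero * ι (ℤ.- (+ N ℤ.* σ i))           ≡⟨ cong (λ z → a zero * ι z) (ℤ.neg-distribʳ-* (+ N) (σ i)) ⟩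
            a zero * ι (+ N ℤ.* ℤ.- σ i)             ≡⟨ cong (a zero *_) (ι-* (+ N) (ℤ.- σ i)) ⟩
            a zero * (ι (+ N) * ι (ℤ.- σ i))         ≡⟨ sym (ℚ.*-assoc (a zero) (ι (+ N)) (ι (ℤ.- σ i))) ⟩
            a zero * ι (+ N) * ι (ℤ.- σ i)           ∎))
        z = proj₁ multiple
      top≡0-impossible : d ℕ.< ∣ F ∣ → ¬ (a zero ≡ 0ℚ)
      top≡0-impossible d<F c≡0 = lower-impossible (nonzero-lead p (p≢0 j aj≢0))
        where
        open ≡-Reasoning
        p≢0 : ∀ j → a j ≢ 0ℚ → ∃ λ j → p j ≢ 0ℚ
        p≢0 zero a0≢0 = contradiction c≡0 a0≢0
        p≢0 (suc j) aj≢0 = suc j , aj≢0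
        e : ∀ x y → y ≡ 0ℚ * x + y
        e = solve-∀ ℚ-ring
        M^l≢0 : ∀ l → ι (+ M) ^ l ≢ 0ℚ
        M^l≢0 l eq = ℕ.<⇒≢ (M^m>0 l) (ℤ.+-injective (sym (ι-injective (trans (sym (ι-^ l)) (trans eq (sym ι-0))))))
        lower-impossible : ¬ (∃ λ l → l ℕ.< d × ∃ λ c → c ≢ 0ℚ × Lead l c (λ t → dot p (powers t)))
        lower-impossible (l , l<d , c , c≢0 , lead) =
          c≢0 (*-cancelˡ-0 (M^l≢0 l) (trans (proj₂ multiple) (ℚ.*-zeroˡ (ι (proj₁ multiple)))))
          where
          -- With C = 0 the lemma says that vanishing on F forces M ^ l c = 0.
          multiple = top-coefficient-multiple (ι (+ M)) 0ℚ T F T-differences lead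
            (ℕ.<-trans l<d d<F) (λ i i∈F → 0ℤ , (begin
              dot p (powers (T i))                     ≡⟨ e (T i ^ d) _ ⟩
              0ℚ * T i ^ d + dot p (powers (T i))      ≡⟨ cong (λ z → z * T i ^ d + dot p (powers (T i))) (sym c≡0) ⟩
              a zero * T i ^ d + dot p (powers (T i))  ≡⟨ value i i∈F ⟩
              a zero * (- shift i)                     ≡⟨ cong (_* (- shift i)) c≡0 ⟩
              0ℚ * (- shift i)                         ≡⟨ ℚ.*-zeroˡ (- shift i) ⟩
              0ℚ                                       ≡⟨ sym (ℚ.*-zeroˡ (ι 0ℤ)) ⟩
              0ℚ * ι 0ℤ                                ∎))

  module _ (t-injective : ∀ {i j} → t i ≡ t j → i ≡ j) (2≤d₀ : 2 ℕ.≤ d₀) (1<n : 1 ℕ.< n) where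

    -- The square of t - T i vanishes only at the i-th point. Its degree 2 is below d, so the shift
    -- enters with coefficient 0.
    vertex : ∀ i → ProperFace v ⁅ i ⁆
    vertex i = affine-properFace {v = v} {φ = λ k → square (T k) + 0ℚ * shift k} {F = ⁅ i ⁆}
      (lead-affine {φ = square} (lead-raise (ℕ.<⇒<′ (s≤s 2≤d₀)) square-lead))
      (λ k → subst (0ℚ ≤_) (e₀ (T k) (T i) (shift k)) (square≥0 (T k - T i)))
      (λ k → mk⇔
        (λ eq → subst (_∈ ⁅ i ⁆) (sym (root k eq)) (x∈⁅x⁆ i))
        (λ k∈ → trans (cong (λ l → square (T l) + 0ℚ * shift l) (x∈⁅y⁆⇒x≡y i k∈)) (e₂ (T i) (shift i))))
      (i , x∈⁅x⁆ i)
      (missing ⁅ i ⁆ (subst (ℕ._< n) (sym (∣⁅x⁆∣≡1 i)) 1<n))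
      where
      square : ℚ → ℚ
      square x = (1ℚ * x + (- T i)) * ((1ℚ * x + (- T i)) * 1ℚ)
      square-lead : Lead 2 _ square
      square-lead = lead-*-linear 1ℚ (- T i) (lead-*-linear 1ℚ (- T i) (const {1ℚ} λ _ → refl))
      e₀ : ∀ x y s → (x - y) * (x - y) ≡ (1ℚ * x + (- y)) * ((1ℚ * x + (- y)) * 1ℚ) + 0ℚ * s
      e₀ = solve-∀ ℚ-ring
      e₂ : ∀ x s → (1ℚ * x + (- x)) * ((1ℚ * x + (- x)) * 1ℚ) + 0ℚ * s ≡ 0ℚ
      e₂ = solve-∀ ℚ-ring
      square≥0 : ∀ x → 0ℚ ≤ x * x
      square≥0 x with ℚ.≤-total 0ℚ x
      ... | inj₁ 0≤x = 0≤* 0≤x 0≤x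
      ... | inj₂ x≤0 = subst (0ℚ ≤_) (e x) (0≤* (ℚ.neg-antimono-≤ x≤0) (ℚ.neg-antimono-≤ x≤0))
        where
        e : ∀ x → (- x) * (- x) ≡ x * x
        e = solve-∀ ℚ-ring
      root : ∀ k → square (T k) + 0ℚ * shift k ≡ 0ℚ → k ≡ i
      root k eq with T k - T i ℚ.≟ 0ℚ
      ... | yes eq′ = t-injective (ℤ.+-injective (ι-injective (sym (b-x≡0⇒x≡b eq′))))
      ... | no ≢0 = contradiction (*-cancelˡ-0 ≢0 (trans (e₀ (T k) (T i) (shift k)) eq)) ≢0

-- Products over pairs of points

prod : ∀ {r} → Subset r → (Fin r → ℕ) → ℕ
prod [] φ = 1
prod (outside ∷ K) φ = prod K (φ ∘ suc)
prod (inside ∷ K) φ = φ zero ℕ.* prod K (φ ∘ suc)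

prod-zero : ∀ {r} {K : Subset r} {φ g} → g ∈ K → φ g ≡ 0 → prod K φ ≡ 0
prod-zero {K = _ ∷ K} {φ} here φg≡0 = cong (ℕ._* prod K (φ ∘ suc)) φg≡0
prod-zero {K = outside ∷ K} (there g∈K) φg≡0 = prod-zero g∈K φg≡0
prod-zero {K = inside ∷ K} {φ} (there g∈K) φg≡0 =
  trans (cong (φ zero ℕ.*_) (prod-zero g∈K φg≡0)) (ℕ.*-zeroʳ (φ zero))

prod-pos : ∀ {r} (K : Subset r) {φ} → (∀ {g} → g ∈ K → 0 ℕ.< φ g) → 0 ℕ.< prod K φ
prod-pos [] φ>0 = s≤s z≤n
prod-pos (outside ∷ K) φ>0 = prod-pos K (φ>0 ∘ there)
prod-pos (inside ∷ K) φ>0 = ℕ.*-mono-< (φ>0 here) (prod-pos K (φ>0 ∘ there))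

prod-ratio : ∀ {r} (K : Subset r) {φ ψ : Fin r → ℕ} {C} → 1 ℕ.≤ C →
  (∀ {h} → h ∈ K → φ h ℕ.≤ C ℕ.* ψ h) → prod K φ ℕ.≤ C ℕ.^ r ℕ.* prod K ψ
prod-ratio [] 1≤C φ≤ = ℕ.≤-refl
prod-ratio {suc r} (outside ∷ K) {ψ = ψ} {C} 1≤C φ≤ =
  ℕ.≤-trans (prod-ratio K 1≤C (φ≤ ∘ there))
    (ℕ.*-monoˡ-≤ (prod K (ψ ∘ suc)) (ℕ.m≤n*m (C ℕ.^ r) C {{ℕ.>-nonZero 1≤C}}))
prod-ratio {suc r} (inside ∷ K) {φ} {ψ} {C} 1≤C φ≤ =
  ℕ.≤-trans (ℕ.*-mono-≤ (φ≤ here) (prod-ratio K 1≤C (φ≤ ∘ there)))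
    (ℕ.≤-reflexive (e C (ψ zero) (C ℕ.^ r) (prod K (ψ ∘ suc))))
  where
  e : ∀ a b c d → (a ℕ.* b) ℕ.* (c ℕ.* d) ≡ (a ℕ.* c) ℕ.* (b ℕ.* d)
  e = ℕRing.solve-∀

-- The products without their factor g differ by at most C ^ r, cross-multiplied to stay in ℕ. The
-- exponent r makes the bound independent of K.
prod-ratio-except : ∀ {r} {K : Subset r} {φ ψ : Fin r → ℕ} {C g} → 1 ℕ.≤ C → g ∈ K →
  (∀ {h} → h ∈ K → h ≢ g → φ h ℕ.≤ C ℕ.* ψ h) →
  prod K φ ℕ.* ψ g ℕ.≤ C ℕ.^ r ℕ.* φ g ℕ.* prod K ψ
prod-ratio-except {suc r} {_ ∷ K} {φ} {ψ} {C} 1≤C here φ≤ = begin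
  φ zero ℕ.* prod K (φ ∘ suc) ℕ.* ψ zero
    ≡⟨ e₁ (φ zero) (prod K (φ ∘ suc)) (ψ zero) ⟩
  φ zero ℕ.* ψ zero ℕ.* prod K (φ ∘ suc)
    ≤⟨ ℕ.*-monoʳ-≤ (φ zero ℕ.* ψ zero) (prod-ratio K 1≤C (λ h∈K → φ≤ (there h∈K) λ ())) ⟩
  φ zero ℕ.* ψ zero ℕ.* (C ℕ.^ r ℕ.* prod K (ψ ∘ suc))
    ≤⟨ ℕ.*-monoʳ-≤ (φ zero ℕ.* ψ zero) (ℕ.*-monoˡ-≤ (prod K (ψ ∘ suc)) (ℕ.m≤n*m (C ℕ.^ r) C {{ℕ.>-nonZero 1≤C}})) ⟩
  φ zero ℕ.* ψ zero ℕ.* (C ℕ.* C ℕ.^ r ℕ.* prod K (ψ ∘ suc))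
    ≡⟨ e₂ (φ zero) (ψ zero) (C ℕ.* C ℕ.^ r) (prod K (ψ ∘ suc)) ⟩
  C ℕ.* C ℕ.^ r ℕ.* φ zero ℕ.* (ψ zero ℕ.* prod K (ψ ∘ suc)) ∎
  where
  open ℕ.≤-Reasoning
  e₁ : ∀ a b c → a ℕ.* b ℕ.* c ≡ a ℕ.* c ℕ.* b
  e₁ = ℕRing.solve-∀
  e₂ : ∀ a b c d → a ℕ.* b ℕ.* (c ℕ.* d) ≡ c ℕ.* a ℕ.* (b ℕ.* d)
  e₂ = ℕRing.solve-∀
prod-ratio-except {suc r} {outside ∷ K} {φ} {ψ} {C} {suc g} 1≤C (there g∈K) φ≤ =
  ℕ.≤-trans (prod-ratio-except 1≤C g∈K (λ h∈K h≢g → φ≤ (there h∈K) (h≢g ∘ Fin.suc-injective)))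
    (ℕ.*-monoˡ-≤ (prod K (ψ ∘ suc)) (ℕ.*-monoˡ-≤ (φ (suc g)) (ℕ.m≤n*m (C ℕ.^ r) C {{ℕ.>-nonZero 1≤C}})))
prod-ratio-except {suc r} {inside ∷ K} {φ} {ψ} {C} {suc g} 1≤C (there g∈K) φ≤ = begin
  φ zero ℕ.* prod K (φ ∘ suc) ℕ.* ψ (suc g)
    ≡⟨ ℕ.*-assoc (φ zero) _ _ ⟩
  φ zero ℕ.* (prod K (φ ∘ suc) ℕ.* ψ (suc g))
    ≤⟨ ℕ.*-mono-≤ (φ≤ here λ ()) (prod-ratio-except 1≤C g∈K (λ h∈K h≢g → φ≤ (there h∈K) (h≢g ∘ Fin.suc-injective))) ⟩
  C ℕ.* ψ zero ℕ.* (C ℕ.^ r ℕ.* φ (suc g) ℕ.* prod K (ψ ∘ suc))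
    ≡⟨ e C (ψ zero) (C ℕ.^ r) (φ (suc g)) (prod K (ψ ∘ suc)) ⟩
  C ℕ.* C ℕ.^ r ℕ.* φ (suc g) ℕ.* (ψ zero ℕ.* prod K (ψ ∘ suc)) ∎
  where
  open ℕ.≤-Reasoning
  e : ∀ a b c d e → a ℕ.* b ℕ.* (c ℕ.* d ℕ.* e) ≡ a ℕ.* c ℕ.* d ℕ.* (b ℕ.* e)
  e = ℕRing.solve-∀

prod-bound : ∀ {r} (K : Subset r) {φ B} → 1 ℕ.≤ B → (∀ h → φ h ℕ.≤ B) → prod K φ ℕ.≤ B ℕ.^ r
prod-bound [] 1≤B φ≤ = ℕ.≤-refl
prod-bound {suc r} (outside ∷ K) {B = B} 1≤B φ≤ =
  ℕ.≤-trans (prod-bound K 1≤B (φ≤ ∘ suc)) (ℕ.m≤n*m (B ℕ.^ r) B {{ℕ.>-nonZero 1≤B}})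
prod-bound (inside ∷ K) 1≤B φ≤ = ℕ.*-mono-≤ (φ≤ zero) (prod-bound K 1≤B (φ≤ ∘ suc))

-- The linear factors are written in the form that `lead-*-linear` produces.
pairPoly : ∀ {r} → Subset r → (x y : Fin r → ℕ) → ℚ → ℚ
pairPoly [] x y t = 1ℚ
pairPoly (outside ∷ K) x y t = pairPoly K (x ∘ suc) (y ∘ suc) t
pairPoly (inside ∷ K) x y t =
  (1ℚ * t + - ι (+ x zero)) * ((1ℚ * t + - ι (+ y zero)) * pairPoly K (x ∘ suc) (y ∘ suc) t)

pairPoly-lead : ∀ {r} (K : Subset r) x y → Lead (∣ K ∣ ℕ.* 2) 1ℚ (pairPoly K x y)
pairPoly-lead [] x y = const λ _ → refl
pairPoly-lead (outside ∷ K) x y = pairPoly-lead K (x ∘ suc) (y ∘ suc)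
pairPoly-lead (inside ∷ K) x y =
  lead-*-linear 1ℚ (- ι (+ x zero)) (lead-*-linear 1ℚ (- ι (+ y zero)) (pairPoly-lead K (x ∘ suc) (y ∘ suc)))

+dist-≥ : ∀ {x t} → x ℕ.≤ t → + (dist t x) ≡ + t ℤ.- + x
+dist-≥ {x} {t} x≤t = trans (cong +_ (ℕ.m≤n⇒∣n-m∣≡n∸m x≤t))
  (trans (sym (ℤ.⊖-≥ x≤t)) (sym (ℤ.m-n≡m⊖n t x)))

+dist-≤ : ∀ {x t} → t ℕ.≤ x → + (dist t x) ≡ ℤ.- (+ t ℤ.- + x)
+dist-≤ {x} {t} t≤x = trans (cong +_ (ℕ.∣-∣-comm t x)) (trans (+dist-≥ t≤x) (sub-swap (+ x) (+ t)))
  where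
  sub-swap : ∀ i j → i ℤ.- j ≡ ℤ.- (j ℤ.- i)
  sub-swap = ℤRing.solve-∀

-- The condition under which (t - x)(t - y) is nonnegative, hence equal to the natural number
-- `gap x y t`.
SameSide : ℕ → ℕ → ℕ → Set
SameSide x y t = (t ℕ.≤ x × t ℕ.≤ y) ⊎ (x ℕ.≤ t × y ℕ.≤ t)

gap : ℕ → ℕ → ℕ → ℕ
gap x y t = (dist t x) ℕ.* (dist t y)

gap-≡ : ∀ {x y t} → SameSide x y t → ι (+ gap x y t) ≡ (ι (+ t) - ι (+ x)) * (ι (+ t) - ι (+ y))
gap-≡ {x} {y} {t} side = begin
  ι (+ gap x y t)                                 ≡⟨ cong ι (ℤ.pos-* (dist t x) (dist t y)) ⟩
  ι (+ (dist t x) ℤ.* + (dist t y))                 ≡⟨ cong ι (signs side) ⟩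
  ι ((+ t ℤ.- + x) ℤ.* (+ t ℤ.- + y))             ≡⟨ ι-* (+ t ℤ.- + x) (+ t ℤ.- + y) ⟩
  ι (+ t ℤ.- + x) * ι (+ t ℤ.- + y)               ≡⟨ cong₂ _*_ (ι-- (+ t) (+ x)) (ι-- (+ t) (+ y)) ⟩
  (ι (+ t) - ι (+ x)) * (ι (+ t) - ι (+ y))       ∎
  where
  open ≡-Reasoning
  signs : SameSide x y t → + (dist t x) ℤ.* + (dist t y) ≡ (+ t ℤ.- + x) ℤ.* (+ t ℤ.- + y)
  signs (inj₁ (t≤x , t≤y)) = trans (cong₂ ℤ._*_ (+dist-≤ t≤x) (+dist-≤ t≤y)) (neg*neg (+ t ℤ.- + x) (+ t ℤ.- + y))
    where
    neg*neg : ∀ i j → (ℤ.- i) ℤ.* (ℤ.- j) ≡ i ℤ.* j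
    neg*neg = ℤRing.solve-∀
  signs (inj₂ (x≤t , y≤t)) = cong₂ ℤ._*_ (+dist-≥ x≤t) (+dist-≥ y≤t)

pairPoly-≡ : ∀ {r} (K : Subset r) x y {t} → (∀ g → SameSide (x g) (y g) t) →
  pairPoly K x y (ι (+ t)) ≡ ι (+ prod K (λ g → gap (x g) (y g) t))
pairPoly-≡ [] x y side = sym ι-1
pairPoly-≡ (outside ∷ K) x y side = pairPoly-≡ K (x ∘ suc) (y ∘ suc) (side ∘ suc)
pairPoly-≡ (inside ∷ K) x y {t} side = begin
  (1ℚ * u + - a) * ((1ℚ * u + - b) * P)     ≡⟨ e u a b P ⟩
  (u - a) * (u - b) * P                     ≡⟨ cong₂ _*_ (sym (gap-≡ (side zero))) (pairPoly-≡ K (x ∘ suc) (y ∘ suc) (side ∘ suc)) ⟩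
  ι (+ G) * ι (+ R)                         ≡⟨ sym (ι-* (+ G) (+ R)) ⟩
  ι (+ G ℤ.* + R)                           ≡⟨ cong ι (sym (ℤ.pos-* G R)) ⟩
  ι (+ (G ℕ.* R))                           ∎
  where
  open ≡-Reasoning
  u = ι (+ t)
  a = ι (+ x zero)
  b = ι (+ y zero)
  P = pairPoly K (x ∘ suc) (y ∘ suc) u
  G = gap (x zero) (y zero) t
  R = prod K (λ g → gap (x (suc g)) (y (suc g)) t)
  e : ∀ u a b p → (1ℚ * u + - a) * ((1ℚ * u + - b) * p) ≡ (u - a) * (u - b) * p
  e = solve-∀ ℚ-ring

subset-of-size : ∀ {r} (K : Subset r) {k} → k ℕ.≤ ∣ K ∣ → ∃ λ L → L ⊆ K × ∣ L ∣ ≡ k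
subset-of-size {r} K {zero} _ = ⊥ , ⊆-min K , ∣⊥∣≡0 r
subset-of-size (outside ∷ K) {suc k} k≤K with subset-of-size K k≤K
... | L , L⊆K , L≡k = outside ∷ L , (λ { (there x∈L) → there (L⊆K x∈L) }) , L≡k
subset-of-size (inside ∷ K) {suc k} (s≤s k≤K) with subset-of-size K k≤K
... | L , L⊆K , L≡k = inside ∷ L , (λ { here → here ; (there x∈L) → there (L⊆K x∈L) }) , cong suc L≡k

pairs-count : ∀ {r n} (K : Subset r) {x y : Fin r → Fin n} {F : Subset n} →
  (∀ {g h} → x g ≡ x h → g ≡ h) → (∀ {g h} → y g ≡ y h → g ≡ h) → (∀ {g h} → x g ≢ y h) →
  (∀ {g} → g ∈ K → x g ∈ F × y g ∈ F) → ∣ K ∣ ℕ.* 2 ℕ.≤ ∣ F ∣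
pairs-count [] x-inj y-inj x≢y in-F = z≤n
pairs-count (outside ∷ K) x-inj y-inj x≢y in-F =
  pairs-count K (Fin.suc-injective ∘ x-inj) (Fin.suc-injective ∘ y-inj) x≢y (in-F ∘ there)
pairs-count (inside ∷ K) {x} {y} {F} x-inj y-inj x≢y in-F =
  ℕ.≤-trans (s≤s (s≤s (pairs-count K {x ∘ suc} {y ∘ suc} {F ∖ x zero ∖ y zero}
      (Fin.suc-injective ∘ x-inj) (Fin.suc-injective ∘ y-inj) x≢y rest)))
    (ℕ.≤-trans (s≤s (x∈p⇒∣p-x∣<∣p∣ (x∈p∧x≢y⇒x∈p-y (proj₂ (in-F here)) (x≢y ∘ sym))))
      (x∈p⇒∣p-x∣<∣p∣ (proj₁ (in-F here))))
  where
  zero≢suc : ∀ {z : Fin _ → Fin _} → (∀ {g h} → z g ≡ z h → g ≡ h) → ∀ {g} → z (suc g) ≢ z zero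
  zero≢suc z-inj eq = contradiction (z-inj eq) λ ()
  rest : ∀ {g} → g ∈ K → x (suc g) ∈ F ∖ x zero ∖ y zero × y (suc g) ∈ F ∖ x zero ∖ y zero
  rest g∈K =
    x∈p∧x≢y⇒x∈p-y (x∈p∧x≢y⇒x∈p-y (proj₁ (in-F (there g∈K))) (zero≢suc {x} x-inj)) x≢y ,
    x∈p∧x≢y⇒x∈p-y (x∈p∧x≢y⇒x∈p-y (proj₂ (in-F (there g∈K))) (x≢y ∘ sym)) (zero≢suc {y} y-inj)

-- Points in widely separated blocks

-- Block h starts at h (2 G) and has length at most G, so different blocks are at least G apart and
-- no position exceeds `span r G`.
span : ℕ → ℕ → ℕ
span r G = r ℕ.* (2 ℕ.* G)

maxValue : ℕ → ℕ → ℕ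
maxValue r G = (span r G ℕ.* span r G) ℕ.^ r

-- The first summand makes N exceed (span !)^d, for general position; the second makes the N σ
-- part of an event dominate the part coming from the moment curve.
threshold : ℕ → ℕ → ℕ → ℕ
threshold r G d = (span r G !) ℕ.^ d ℕ.+ (span r G ℕ.+ span r G) ℕ.* (maxValue r G ℕ.* maxValue r G)

module Blocks {r s : ℕ} (τ : Fin s → ℕ) (G : ℕ) (1≤r : 1 ℕ.≤ r) (1≤G : 1 ℕ.≤ G)
              (τ≤G : ∀ j → τ j ℕ.≤ G) (τ-injective : ∀ {i j} → τ i ≡ τ j → i ≡ j) where

  pos : Fin r → Fin s → ℕ
  pos h j = toℕ h ℕ.* (2 ℕ.* G) ℕ.+ τ j

  t : Fin (r ℕ.* s) → ℕ
  t i = pos (proj₁ (remQuot s i)) (proj₂ (remQuot {r} s i))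

  range : ℕ
  range = span r G

  t-combine : ∀ h j → t (combine h j) ≡ pos h j
  t-combine h j = cong (λ hj → pos (proj₁ hj) (proj₂ hj)) (Fin.remQuot-combine {r} {s} h j)

  pos+G≤ : ∀ h j → pos h j ℕ.+ G ℕ.≤ suc (toℕ h) ℕ.* (2 ℕ.* G)
  pos+G≤ h j = begin
    toℕ h ℕ.* (2 ℕ.* G) ℕ.+ τ j ℕ.+ G        ≤⟨ ℕ.+-monoˡ-≤ G (ℕ.+-monoʳ-≤ (toℕ h ℕ.* (2 ℕ.* G)) (τ≤G j)) ⟩
    toℕ h ℕ.* (2 ℕ.* G) ℕ.+ G ℕ.+ G          ≡⟨ e (toℕ h ℕ.* (2 ℕ.* G)) G ⟩
    suc (toℕ h) ℕ.* (2 ℕ.* G)                ∎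
    where
    open ℕ.≤-Reasoning
    e : ∀ x G → x ℕ.+ G ℕ.+ G ≡ 2 ℕ.* G ℕ.+ x
    e = ℕRing.solve-∀

  pos-≤-range : ∀ h j → pos h j ℕ.≤ range
  pos-≤-range h j = ℕ.≤-trans (ℕ.m≤m+n (pos h j) G)
    (ℕ.≤-trans (pos+G≤ h j) (ℕ.*-monoˡ-≤ (2 ℕ.* G) (Fin.toℕ<n h)))

  separated : ∀ {h h′} → toℕ h ℕ.< toℕ h′ → ∀ j j′ → pos h j ℕ.+ G ℕ.≤ pos h′ j′
  separated {h} {h′} h<h′ j j′ = ℕ.≤-trans (pos+G≤ h j)
    (ℕ.≤-trans (ℕ.*-monoˡ-≤ (2 ℕ.* G) h<h′) (ℕ.m≤m+n _ (τ j′)))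

  dist-≥-G : ∀ {h h′} → h ≢ h′ → ∀ j j′ → G ℕ.≤ dist (pos h j) (pos h′ j′)
  dist-≥-G {h} {h′} h≢h′ j j′ with ℕ.<-cmp (toℕ h) (toℕ h′)
  ... | tri≈ _ h≡h′ _ = contradiction (Fin.toℕ-injective h≡h′) h≢h′
  ... | tri< h<h′ _ _ = ℕ.≤-trans (ℕ.m+n≤o⇒m≤o∸n G (subst (ℕ._≤ pos h′ j′) (ℕ.+-comm (pos h j) G) (separated h<h′ j j′)))
    (ℕ.≤-trans (ℕ.m∸n≤∣m-n∣ (pos h′ j′) (pos h j)) (ℕ.≤-reflexive (ℕ.∣-∣-comm (pos h′ j′) (pos h j))))
  ... | tri> _ _ h′<h = ℕ.≤-trans (ℕ.m+n≤o⇒m≤o∸n G (subst (ℕ._≤ pos h j) (ℕ.+-comm (pos h′ j′) G) (separated h′<h j′ j)))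
    (ℕ.m∸n≤∣m-n∣ (pos h j) (pos h′ j′))

  pos-injective : ∀ {h j h′ j′} → pos h j ≡ pos h′ j′ → h ≡ h′ × j ≡ j′
  pos-injective {h} {j} {h′} {j′} eq with h Fin.≟ h′
  ... | yes refl = refl , τ-injective (ℕ.+-cancelˡ-≡ (toℕ h ℕ.* (2 ℕ.* G)) (τ j) (τ j′) eq)
  ... | no h≢h′ = contradiction (ℕ.≤-trans 1≤G (dist-≥-G h≢h′ j j′))
    (ℕ.<⇒≱ (s≤s (ℕ.≤-reflexive (ℕ.m≡n⇒∣m-n∣≡0 eq))))

  t-injective : ∀ {i i′} → t i ≡ t i′ → i ≡ i′
  t-injective {i} {i′} eq = trans (sym (Fin.combine-remQuot {r} s i))
    (trans (cong₂ combine (proj₁ same) (proj₂ same)) (Fin.combine-remQuot {r} s i′))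
    where same = pos-injective eq

  t-≤-range : ∀ i → t i ℕ.≤ range
  t-≤-range i = pos-≤-range (proj₁ (remQuot s i)) (proj₂ (remQuot {r} s i))

  dist-≤-range : ∀ {x y} → x ℕ.≤ range → y ℕ.≤ range → dist x y ℕ.≤ range
  dist-≤-range {x} {y} x≤ y≤ = ℕ.≤-trans (ℕ.∣m-n∣≤m⊔n x y) (ℕ.⊔-lub x≤ y≤)

  -- The common multiple M that general position asks for: a nonzero difference of size at most
  -- `range` divides `range !`.
  range!-divisible : ∀ {i i′} → i ≢ i′ → ∃ λ y → y ℤ.* (+ t i ℤ.- + t i′) ≡ + (range !)
  range!-divisible {i} {i′} i≢i′
    with small (dist-≤-range (t-≤-range i) (t-≤-range i′)) (λ eq → i≢i′ (t-injective (ℕ.∣m-n∣≡0⇒m≡n eq)))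
    where
    small : ∀ {k m} → k ℕ.≤ m → k ≢ 0 → k ∣ℕ m !
    small {zero} _ 0≢0 = contradiction refl 0≢0
    small {suc k} k<m _ = ∣-trans (m∣m*n (k !)) (m≤n⇒m!∣n! k<m)
  ... | divides q eq with ℕ.≤-total (t i′) (t i)
  ... | inj₁ ≤ = + q , trans (cong (+ q ℤ.*_) (sym (+dist-≥ ≤)))
    (trans (sym (ℤ.pos-* q _)) (cong +_ (sym eq)))
  ... | inj₂ ≥ = ℤ.- + q , trans (neg-swap (+ q) (+ t i) (+ t i′)) (trans (cong (+ q ℤ.*_) (sym (+dist-≤ ≥)))
    (trans (sym (ℤ.pos-* q _)) (cong +_ (sym eq))))
    where
    neg-swap : ∀ q a b → (ℤ.- q) ℤ.* (a ℤ.- b) ≡ q ℤ.* (ℤ.- (a ℤ.- b))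
    neg-swap = ℤRing.solve-∀

  gap-same-block : ∀ h p q j → gap (pos h p) (pos h q) (pos h j) ≡ gap (τ p) (τ q) (τ j)
  gap-same-block h p q j = cong₂ ℕ._*_ (shift p) (shift q)
    where shift = λ p → ℕ.∣m+n-m+o∣≡∣n-o∣ (toℕ h ℕ.* (2 ℕ.* G)) (τ j) (τ p)

  gap-other-block : ∀ {h g} → h ≢ g → ∀ p q j → G ℕ.* G ℕ.≤ gap (pos g p) (pos g q) (pos h j)
  gap-other-block h≢g p q j = ℕ.*-mono-≤ (dist-≥-G h≢g j p) (dist-≥-G h≢g j q)

  gap-≤ : ∀ h g p q j → gap (pos g p) (pos g q) (pos h j) ℕ.≤ range ℕ.* range
  gap-≤ h g p q j = ℕ.*-mono-≤ (dist-≤-range (pos-≤-range h j) (pos-≤-range g p))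
                               (dist-≤-range (pos-≤-range h j) (pos-≤-range g q))

  -- Another block lies wholly on one side of block g; within block g the neighbour property
  -- decides.
  sameSide : ∀ {p q} → (∀ j → SameSide (τ p) (τ q) (τ j)) → ∀ h j g → SameSide (pos g p) (pos g q) (pos h j)
  sameSide {p} {q} adjacent h j g with ℕ.<-cmp (toℕ h) (toℕ g)
  ... | tri< h<g _ _ = inj₁ (below p , below q)
    where below = λ p → ℕ.≤-trans (ℕ.m≤m+n (pos h j) G) (separated h<g j p)
  ... | tri> _ _ g<h = inj₂ (above p , above q)
    where above = λ p → ℕ.≤-trans (ℕ.m≤m+n (pos g p) G) (separated g<h p j)
  ... | tri≈ _ h≡g _ with Fin.toℕ-injective h≡g
  ... | refl = Sum.map both both (adjacent j)
    where
    both : ∀ {a b c d} → a ℕ.≤ b × c ℕ.≤ d → toℕ h ℕ.* (2 ℕ.* G) ℕ.+ a ℕ.≤ toℕ h ℕ.* (2 ℕ.* G) ℕ.+ b × toℕ h ℕ.* (2 ℕ.* G) ℕ.+ c ℕ.≤ toℕ h ℕ.* (2 ℕ.* G) ℕ.+ d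
    both (x , y) = ℕ.+-monoʳ-≤ _ x , ℕ.+-monoʳ-≤ _ y

  1≤range : 1 ℕ.≤ range
  1≤range = ℕ.*-mono-≤ 1≤r (ℕ.≤-trans 1≤G (ℕ.m≤m+n G (G ℕ.+ 0)))

  value : Subset r → Fin s → Fin s → Fin (r ℕ.* s) → ℕ
  value K p q i = prod K λ g → gap (pos g p) (pos g q) (t i)

  valueBound : ℕ
  valueBound = maxValue r G

  1≤valueBound : 1 ℕ.≤ valueBound
  1≤valueBound = ℕ.m^n>0 (range ℕ.* range) {{ℕ.>-nonZero (ℕ.*-mono-≤ 1≤range 1≤range)}} r

  value-≤ : ∀ K p q i → value K p q i ℕ.≤ valueBound
  value-≤ K p q i = prod-bound K (ℕ.*-mono-≤ 1≤range 1≤range)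
    (λ g → gap-≤ (proj₁ (remQuot s i)) g p q (proj₂ (remQuot {r} s i)))

  value-zero : ∀ {K p q g j} → g ∈ K → j ≡ p ⊎ j ≡ q → value K p q (combine g j) ≡ 0
  value-zero {K} {p} {q} {g} {j} g∈K j∈ = prod-zero g∈K (trans (cong (gap (pos g p) (pos g q)) (t-combine g j)) (gap-zero j∈))
    where
    gap-zero : j ≡ p ⊎ j ≡ q → gap (pos g p) (pos g q) (pos g j) ≡ 0
    gap-zero (inj₁ refl) = cong (ℕ._* dist (pos g p) (pos g q)) (ℕ.∣n-n∣≡0 (pos g p))
    gap-zero (inj₂ refl) = trans (cong (dist (pos g q) (pos g p) ℕ.*_) (ℕ.∣n-n∣≡0 (pos g q)))
                                 (ℕ.*-zeroʳ (dist (pos g q) (pos g p)))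

  gap-pos : ∀ {p q j} h g → (h ≡ g → j ≢ p × j ≢ q) → 0 ℕ.< gap (pos g p) (pos g q) (pos h j)
  gap-pos {p} {q} {j} h g off = ℕ.*-mono-< (ℕ.n≢0⇒n>0 λ eq → clash p (ℕ.∣m-n∣≡0⇒m≡n eq) (proj₁ ∘ off))
                                           (ℕ.n≢0⇒n>0 λ eq → clash q (ℕ.∣m-n∣≡0⇒m≡n eq) (proj₂ ∘ off))
    where
    clash : ∀ p → pos h j ≡ pos g p → ¬ (h ≡ g → j ≢ p)
    clash p eq off with pos-injective eq
    ... | h≡g , j≡p = off h≡g j≡p

  value-pos : ∀ K {p q h j} → (h ∈ K → j ≢ p × j ≢ q) → 0 ℕ.< value K p q (combine h j)
  value-pos K {p} {q} {h} {j} off = prod-pos K λ {g} g∈K →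
    subst (λ x → 0 ℕ.< gap (pos g p) (pos g q) x) (sym (t-combine h j))
      (gap-pos h g λ { refl → off g∈K })

  value-poly : ∀ K {p q} → (∀ j → SameSide (τ p) (τ q) (τ j)) → ∀ i →
    pairPoly K (λ g → pos g p) (λ g → pos g q) (ι (+ t i)) ≡ ι (+ value K p q i)
  value-poly K adjacent i = pairPoly-≡ K _ _
    (sameSide adjacent (proj₁ (remQuot s i)) (proj₂ (remQuot {r} s i)))

  pairs-size : ∀ K {p q} → p ≢ q → ∀ {F : Subset (r ℕ.* s)} →
    (∀ {g} → g ∈ K → combine g p ∈ F × combine g q ∈ F) → ∣ K ∣ ℕ.* 2 ℕ.≤ ∣ F ∣
  pairs-size K {p} {q} p≢q {F} = pairs-count K {λ g → combine g p} {λ g → combine g q} {F}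
    (λ {g} {h} → Fin.combine-injectiveˡ {r} {s} g p h p) (λ {g} {h} → Fin.combine-injectiveˡ {r} {s} g q h q)
    (λ {g} {h} eq → p≢q (Fin.combine-injectiveʳ {r} {s} g p h q eq))

-- The order in which a pencil of hyperplanes reaches points

dominates : ∀ (x : ℤ) N w → ℤ.∣ x ∣ ℕ.< N → 0ℤ ℤ.< w → 0ℤ ℤ.< x ℤ.+ + N ℤ.* w
dominates x N (+ suc w) x<N _ = subst (λ z → 0ℤ ℤ.< x ℤ.+ z) (ℤ.pos-* N (suc w)) (positive-sum x (ℕ.<-≤-trans x<N (ℕ.m≤m*n N (suc w))))
  where
  positive-sum : ∀ x {m} → ℤ.∣ x ∣ ℕ.< m → 0ℤ ℤ.< x ℤ.+ + m
  positive-sum (+ a) a<m = ℤ.+<+ (ℕ.<-≤-trans (ℕ.≤-<-trans z≤n a<m) (ℕ.m≤n+m _ a))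
  positive-sum -[1+ a ] {m} a<m = subst (0ℤ ℤ.<_) (sym (ℤ.⊖-≥ (ℕ.<⇒≤ a<m))) (ℤ.+<+ (ℕ.m<n⇒0<n∸m a<m))
dominates x N (+ zero) _ (ℤ.+<+ ())

0<-sub : ∀ {i j} → i ℤ.< j → 0ℤ ℤ.< j ℤ.- i
0<-sub {i} {j} i<j = subst (ℤ._< j ℤ.- i) (ℤ.+-inverseʳ i) (ℤ.+-monoˡ-< (ℤ.- i) i<j)

<-from-0< : ∀ {i j} → 0ℤ ℤ.< j ℤ.- i → i ℤ.< j
<-from-0< {i} {j} h = subst₂ ℤ._<_ (ℤ.+-identityˡ i) (e i j) (ℤ.+-monoˡ-< i h)
  where
  e : ∀ i j → j ℤ.- i ℤ.+ i ≡ j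
  e = ℤRing.solve-∀

-- With A decreasing from ∞, the hyperplane A Q + event = 0 reaches the points with smallest event / Q first.
event : (ζ : ℤ) (N t Q : ℕ) (δ : ℤ) → ℤ
event ζ N t Q δ = ζ ℤ.* (+ t ℤ.* + Q) ℤ.- + N ℤ.* δ

module _ {ζ : ℤ} (∣ζ∣≡1 : ℤ.∣ ζ ∣ ≡ 1) {T B N : ℕ} (1≤B : 1 ℕ.≤ B) (N-large : (T ℕ.+ T) ℕ.* (B ℕ.* B) ℕ.< N) where

  event-negative : ∀ {t Q δ} → t ℕ.≤ T → Q ℕ.≤ B → 0ℤ ℤ.< δ → event ζ N t Q δ ℤ.< 0ℤ
  event-negative {t} {Q} {δ} t≤T Q≤B 0<δ = <-from-0< (subst (0ℤ ℤ.<_) (e ζ (+ t ℤ.* + Q) (+ N ℤ.* δ))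
    (dominates (ℤ.- (ζ ℤ.* (+ t ℤ.* + Q))) N δ (ℕ.≤-<-trans bound N-large) 0<δ))
    where
    e : ∀ ζ x y → ℤ.- (ζ ℤ.* x) ℤ.+ y ≡ 0ℤ ℤ.- (ζ ℤ.* x ℤ.- y)
    e = ℤRing.solve-∀
    bound : ℤ.∣ ℤ.- (ζ ℤ.* (+ t ℤ.* + Q)) ∣ ℕ.≤ (T ℕ.+ T) ℕ.* (B ℕ.* B)
    bound rewrite ℤ.∣-i∣≡∣i∣ (ζ ℤ.* (+ t ℤ.* + Q)) | ℤ.abs-* ζ (+ t ℤ.* + Q) | ∣ζ∣≡1 | ℤ.abs-* (+ t) (+ Q) | ℕ.+-identityʳ (t ℕ.* Q) =
      ℕ.≤-trans (ℕ.≤-reflexive (cong (t ℕ.*_) (sym (ℕ.*-identityˡ Q))))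
        (ℕ.*-mono-≤ (ℕ.m≤n⇒m≤n+o T t≤T) (ℕ.*-mono-≤ 1≤B Q≤B))

  -- The cross-multiplied difference is N (δ Q′ - δ′ Q) + ζ (t′ - t) Q Q′. The first term is at
  -- least N and the second is below N in size, so the order of arrival is decided by δ / Q alone.
  event-earlier : ∀ {t t′ Q Q′ δ δ′} → t ℕ.≤ T → t′ ℕ.≤ T → Q ℕ.≤ B → Q′ ℕ.≤ B →
    δ′ ℤ.* + Q ℤ.< δ ℤ.* + Q′ → event ζ N t Q δ ℤ.* + Q′ ℤ.< event ζ N t′ Q′ δ′ ℤ.* + Q
  event-earlier {t} {t′} {Q} {Q′} {δ} {δ′} t≤T t′≤T Q≤B Q′≤B slower =
    <-from-0< (subst (0ℤ ℤ.<_) (e ζ (+ t) (+ t′) (+ Q) (+ Q′) δ δ′ (+ N))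
      (dominates (ζ ℤ.* (+ t′ ℤ.- + t) ℤ.* (+ Q ℤ.* + Q′)) N _ (ℕ.≤-<-trans bound N-large) (0<-sub slower)))
    where
    e : ∀ ζ t t′ Q Q′ δ δ′ N → ζ ℤ.* (t′ ℤ.- t) ℤ.* (Q ℤ.* Q′) ℤ.+ N ℤ.* (δ ℤ.* Q′ ℤ.- δ′ ℤ.* Q)
      ≡ (ζ ℤ.* (t′ ℤ.* Q′) ℤ.- N ℤ.* δ′) ℤ.* Q ℤ.- (ζ ℤ.* (t ℤ.* Q) ℤ.- N ℤ.* δ) ℤ.* Q′
    e = ℤRing.solve-∀
    bound : ℤ.∣ ζ ℤ.* (+ t′ ℤ.- + t) ℤ.* (+ Q ℤ.* + Q′) ∣ ℕ.≤ (T ℕ.+ T) ℕ.* (B ℕ.* B)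
    bound rewrite ℤ.abs-* (ζ ℤ.* (+ t′ ℤ.- + t)) (+ Q ℤ.* + Q′) | ℤ.abs-* ζ (+ t′ ℤ.- + t) | ∣ζ∣≡1
                | ℤ.abs-* (+ Q) (+ Q′) | ℕ.+-identityʳ ℤ.∣ + t′ ℤ.- + t ∣ =
      ℕ.*-mono-≤ (ℕ.≤-trans (ℤ.∣i-j∣≤∣i∣+∣j∣ (+ t′) (+ t)) (ℕ.+-mono-≤ t′≤T t≤T)) (ℕ.*-mono-≤ Q≤B Q′≤B)

-- Neighbours p, q of equal height a, and the position c that a hyperplane through such pairs,
-- rotated in direction ζ, reaches before the rest of the block, by a factor of more than W.
record Triple {s : ℕ} (τ : Fin s → ℕ) (σ : Fin s → ℤ) (W G : ℕ) : Set where
  field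
    p q c other : Fin s
    p≢q : p ≢ q
    c≢p : c ≢ p
    c≢q : c ≢ q
    other≢ : other ≢ p × other ≢ q × other ≢ c
    neighbours : ∀ j → SameSide (τ p) (τ q) (τ j)
    ζ a : ℤ
    ∣ζ∣≡1 : ℤ.∣ ζ ∣ ≡ 1

  depth : Fin s → ℤ
  depth j = ζ ℤ.* (a ℤ.- σ j)

  field
    depth-p : depth p ≡ 0ℤ
    depth-q : depth q ≡ 0ℤ
    -- Depths are negative on the side from which the hyperplane turns away. A natural number above
    -- the depth is enough for the rivals of c, while at c it is exact.
    bound : Fin s → ℕ
    depth≤ : ∀ j → depth j ℤ.≤ + bound j
    depth-c : depth c ≡ + bound c
    bound-pos : 0 ℕ.< bound c
    bound≤ : ∀ j → bound j ℕ.≤ bound c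
    first : ∀ j → j ≢ p → j ≢ q → j ≢ c →
      W ℕ.* gap (τ p) (τ q) (τ c) ℕ.* bound j ℕ.< bound c ℕ.* gap (τ p) (τ q) (τ j)
    -- The same margin against blocks that are not chosen: their gaps to the pair are at least G *
    -- G.
    local : W ℕ.* gap (τ p) (τ q) (τ c) ℕ.< G ℕ.* G

-- Facets over a triple in odd dimension

module OddCurve {r s : ℕ} (τ : Fin s → ℕ) (σ : Fin s → ℤ) (G : ℕ) (1≤r : 1 ℕ.≤ r) (1≤G : 1 ℕ.≤ G)
                (τ≤G : ∀ j → τ j ℕ.≤ G) (τ-injective : ∀ {i j} → τ i ≡ τ j → i ≡ j) (k N : ℕ)
                (N-large : threshold r G (suc (k ℕ.* 2)) ℕ.< N) where

  open Blocks {r} {s} τ G 1≤r 1≤G τ≤G τ-injective public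

  height : Fin (r ℕ.* s) → ℤ
  height i = σ (proj₂ (remQuot {r} s i))

  open Curve (k ℕ.* 2) t height N public

  N-dominates : (range ℕ.+ range) ℕ.* (valueBound ℕ.* valueBound) ℕ.< N
  N-dominates = ℕ.≤-<-trans (ℕ.m≤n+m _ _) N-large

  generic : GeneralPosition v
  generic = generalPosition (ℕ.1≤n! range) (ℕ.≤-<-trans (ℕ.m≤m+n _ _) N-large) range!-divisible

  -- Distances between points of different blocks lie between G and 2 r G, so two gaps to the same pair
  -- of another block differ at most by this factor.
  ratio : ℕ
  ratio = (2 ℕ.* r) ℕ.* (2 ℕ.* r)

  module _ (triple : Triple τ σ (ratio ℕ.^ r) G) where
    open Triple triple

    module TripleFacet (K : Subset r) (∣K∣≡k : ∣ K ∣ ≡ k) (g₀ : Fin r) (g₀∈K : g₀ ∈ K)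
                       (k<n : suc (k ℕ.* 2) ℕ.< r ℕ.* s) where

      Q : Fin (r ℕ.* s) → ℕ
      Q = value K p q

      δ : Fin (r ℕ.* s) → ℤ
      δ i = depth (proj₂ (remQuot {r} s i))

      δ-combine : ∀ h j → δ (combine h j) ≡ depth j
      δ-combine h j = cong (λ hj → depth (proj₂ hj)) (Fin.remQuot-combine {r} {s} h j)

      e : Fin (r ℕ.* s) → ℤ
      e i = event ζ N (t i) (Q i) (δ i)

      f g : Fin (r ℕ.* s) → ℚ
      f i = ι (+ Q i)
      g i = ι (e i)

      f≥0 : ∀ i → 0ℚ ≤ f i
      f≥0 i = subst (_≤ f i) ι-0 (ι-mono-≤ (ℤ.+≤+ z≤n))

      P : ℚ → ℚ
      P = pairPoly K (λ h → pos h p) (λ h → pos h q)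

      P-lead : Lead (k ℕ.* 2) 1ℚ P
      P-lead = subst (λ m → Lead (m ℕ.* 2) 1ℚ P) ∣K∣≡k (pairPoly-lead K _ _)

      P≡ : ∀ i → P (T i) ≡ f i
      P≡ = value-poly K neighbours

      f-affine : Affine v f
      f-affine = affine-cong {v = v} (λ i → trans (e₀ (P (T i)) (shift i)) (P≡ i)) (lead-affine (lead-suc P-lead))
        where
        e₀ : ∀ x y → x + 0ℚ * y ≡ x
        e₀ = solve-∀ ℚ-ring

      -- ζ t Q has coefficient ζ at t ^ d, so the curve adds ζ N σ; the constant - N ζ a turns this
      -- into - N δ.
      g-affine : Affine v g
      g-affine = affine-cong {v = v} g≡ (affine-shift {v = v} (- (ι (+ N) * (ι ζ * ι a)))
        (lead-affine (lead-*-linear (ι ζ) 0ℚ P-lead)))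
        where
        open ≡-Reasoning
        e₀ : ∀ z t Q N s a → (z * t + 0ℚ) * Q + z * 1ℚ * (N * s) + - (N * (z * a)) ≡ z * (t * Q) - N * (z * (a - s))
        e₀ = solve-∀ ℚ-ring
        g≡ : ∀ i → (ι ζ * T i + 0ℚ) * P (T i) + ι ζ * 1ℚ * shift i + - (ι (+ N) * (ι ζ * ι a)) ≡ g i
        g≡ i = begin
          (ι ζ * T i + 0ℚ) * P (T i) + ι ζ * 1ℚ * shift i + - (ι (+ N) * (ι ζ * ι a))
            ≡⟨ cong₂ (λ x y → (ι ζ * T i + 0ℚ) * x + ι ζ * 1ℚ * y + - (ι (+ N) * (ι ζ * ι a))) (P≡ i) (ι-* (+ N) (height i)) ⟩
          (ι ζ * T i + 0ℚ) * f i + ι ζ * 1ℚ * (ι (+ N) * ι (height i)) + - (ι (+ N) * (ι ζ * ι a))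
            ≡⟨ e₀ (ι ζ) (T i) (f i) (ι (+ N)) (ι (height i)) (ι a) ⟩
          ι ζ * (T i * f i) - ι (+ N) * (ι ζ * (ι a - ι (height i)))
            ≡⟨ cong₂ (λ x y → ι ζ * x - ι (+ N) * (ι ζ * y)) (sym (ι-* (+ t i) (+ Q i))) (sym (ι-- a (height i))) ⟩
          ι ζ * ι (+ t i ℤ.* + Q i) - ι (+ N) * (ι ζ * ι (a ℤ.- height i))
            ≡⟨ cong₂ (λ x y → x - ι (+ N) * y) (sym (ι-* ζ _)) (sym (ι-* ζ _)) ⟩
          ι (ζ ℤ.* (+ t i ℤ.* + Q i)) - ι (+ N) * ι (δ i)
            ≡⟨ cong (λ y → ι (ζ ℤ.* (+ t i ℤ.* + Q i)) - y) (sym (ι-* (+ N) (δ i))) ⟩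
          ι (ζ ℤ.* (+ t i ℤ.* + Q i)) - ι (+ N ℤ.* δ i)
            ≡⟨ sym (ι-- (ζ ℤ.* (+ t i ℤ.* + Q i)) (+ N ℤ.* δ i)) ⟩
          g i ∎

      third : Fin r → Fin (r ℕ.* s)
      third h = combine h c

      g-third<0 : g (third g₀) < 0ℚ
      g-third<0 = subst (g (third g₀) <_) ι-0 (ι-mono-< (event-negative {ζ = ζ} ∣ζ∣≡1 {range} {valueBound} {N} 1≤valueBound N-dominates {t (third g₀)} {Q (third g₀)} {δ (third g₀)}
        (t-≤-range (third g₀)) (value-≤ K p q (third g₀))
        (subst (0ℤ ℤ.<_) (sym (trans (δ-combine g₀ c) depth-c)) (ℤ.+<+ bound-pos))))

      module Rotated (u : Fin (r ℕ.* s)) (gu<0 : g u < 0ℚ) (h≥0 : ∀ i → 0ℚ ≤ (- g u) * f i + f u * g i) where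

        h : Fin (r ℕ.* s) → ℚ
        h i = (- g u) * f i + f u * g i

        h-affine : Affine v h
        h-affine = affine-lin {v = v} {f} {g} (- g u) (f u) f-affine g-affine

        OnTriple : Fin r → Fin s → Set
        OnTriple b j = b ∈ K × (j ≡ p ⊎ j ≡ q ⊎ j ≡ c)

        -- Depth over Q is compared at i and at `third g`. The factor of Q from block g is handled
        -- by the last hypothesis. Every other factor is at most `range` squared at `third g` and,
        -- by `apart`, at least G squared at i, which costs `ratio` per factor.
        hit-earlier : ∀ {b j g} → g ∈ K → (b ∈ K → j ≢ p × j ≢ q) → (∀ {h} → h ∈ K → h ≢ g → b ≢ h) →
          ratio ℕ.^ r ℕ.* gap (τ p) (τ q) (τ c) ℕ.* bound j ℕ.< bound c ℕ.* gap (pos g p) (pos g q) (pos b j) →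
          δ (combine b j) ℤ.* + Q (third g) ℤ.< δ (third g) ℤ.* + Q (combine b j)
        hit-earlier {b} {j} {g} g∈K off apart earlier = subst₂ (λ x y → x ℤ.* + Q (third g) ℤ.< y ℤ.* + Q i)
          (sym (δ-combine b j)) (sym (trans (δ-combine g c) depth-c))
          (ℤ.≤-<-trans (ℤ.*-monoʳ-≤-nonNeg (+ Q (third g)) (depth≤ j))
            (subst₂ ℤ._<_ (ℤ.pos-* (bound j) (Q (third g))) (ℤ.pos-* (bound c) (Q i)) (ℤ.+<+ main)))
          where
          open ℕ.≤-Reasoning
          i = combine b j
          W = ratio ℕ.^ r
          ℓc = gap (τ p) (τ q) (τ c)
          D = gap (pos g p) (pos g q) (t i)
          gap-third : gap (pos g p) (pos g q) (t (third g)) ≡ ℓc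
          gap-third = trans (cong (gap (pos g p) (pos g q)) (t-combine g c)) (gap-same-block g p q c)
          C≥1 : 1 ℕ.≤ ratio
          C≥1 = ℕ.*-mono-≤ 2r≥1 2r≥1
            where 2r≥1 = ℕ.≤-trans 1≤r (ℕ.m≤m+n r (r ℕ.+ 0))
          factor≤ : ∀ {h} → h ∈ K → h ≢ g →
            gap (pos h p) (pos h q) (t (third g)) ℕ.≤ ratio ℕ.* gap (pos h p) (pos h q) (t i)
          factor≤ {h} h∈K h≢g = begin
            gap (pos h p) (pos h q) (t (third g))    ≡⟨ cong (gap (pos h p) (pos h q)) (t-combine g c) ⟩
            gap (pos h p) (pos h q) (pos g c)        ≤⟨ gap-≤ g h p q c ⟩
            range ℕ.* range                          ≡⟨ e₀ r G ⟩
            ratio ℕ.* (G ℕ.* G)                      ≤⟨ ℕ.*-monoʳ-≤ ratio (gap-other-block (apart h∈K h≢g) p q j) ⟩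
            ratio ℕ.* gap (pos h p) (pos h q) (pos b j) ≡⟨ cong (λ x → ratio ℕ.* gap (pos h p) (pos h q) x) (sym (t-combine b j)) ⟩
            ratio ℕ.* gap (pos h p) (pos h q) (t i)  ∎
            where
            e₀ : ∀ r G → r ℕ.* (2 ℕ.* G) ℕ.* (r ℕ.* (2 ℕ.* G)) ≡ (2 ℕ.* r) ℕ.* (2 ℕ.* r) ℕ.* (G ℕ.* G)
            e₀ = ℕRing.solve-∀
          compare : Q (third g) ℕ.* D ℕ.≤ W ℕ.* ℓc ℕ.* Q i
          compare = subst (λ x → Q (third g) ℕ.* D ℕ.≤ W ℕ.* x ℕ.* Q i) gap-third
            (prod-ratio-except {K = K} {λ h → gap (pos h p) (pos h q) (t (third g))} {λ h → gap (pos h p) (pos h q) (t i)}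
              C≥1 g∈K factor≤)
          Qi>0 : 0 ℕ.< Q i
          Qi>0 = value-pos K off
          e₁ : ∀ a b c → a ℕ.* b ℕ.* c ≡ a ℕ.* (b ℕ.* c)
          e₁ = ℕRing.solve-∀
          e₂ : ∀ a b c → a ℕ.* (b ℕ.* c) ≡ b ℕ.* a ℕ.* c
          e₂ = ℕRing.solve-∀
          e₃ : ∀ a b c → a ℕ.* b ℕ.* c ≡ a ℕ.* c ℕ.* b
          e₃ = ℕRing.solve-∀
          main : bound j ℕ.* Q (third g) ℕ.< bound c ℕ.* Q i
          main = ℕ.*-cancelʳ-< D _ _ (begin-strict
            bound j ℕ.* Q (third g) ℕ.* D      ≡⟨ e₁ (bound j) _ D ⟩
            bound j ℕ.* (Q (third g) ℕ.* D)    ≤⟨ ℕ.*-monoʳ-≤ (bound j) compare ⟩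
            bound j ℕ.* (W ℕ.* ℓc ℕ.* Q i)     ≡⟨ e₂ (bound j) (W ℕ.* ℓc) (Q i) ⟩
            W ℕ.* ℓc ℕ.* bound j ℕ.* Q i       <⟨ ℕ.*-monoˡ-< (Q i) {{ℕ.>-nonZero Qi>0}}
                                                  (subst (λ x → W ℕ.* ℓc ℕ.* bound j ℕ.< bound c ℕ.* gap (pos g p) (pos g q) x)
                                                    (sym (t-combine b j)) earlier) ⟩
            bound c ℕ.* D ℕ.* Q i              ≡⟨ e₃ (bound c) D (Q i) ⟩
            bound c ℕ.* Q i ℕ.* D              ∎)

        off-third : ∀ {b j g} → g ∈ K → (b ∈ K → j ≢ p × j ≢ q) → (∀ {h} → h ∈ K → h ≢ g → b ≢ h) →
          ratio ℕ.^ r ℕ.* gap (τ p) (τ q) (τ c) ℕ.* bound j ℕ.< bound c ℕ.* gap (pos g p) (pos g q) (pos b j) →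
          h (combine b j) ≢ 0ℚ
        off-third {b} {j} {b′} b′∈K off apart earlier hi≡0 =
          pencil-order (0<-neg gu<0) (f≥0 u) fi>0 sooner hi≡0 (h≥0 w)
          where
          i = combine b j
          w = third b′
          fi>0 : 0ℚ < f i
          fi>0 = subst (_< f i) ι-0 (ι-mono-< (ℤ.+<+ (value-pos K off)))
          sooner : g w * f i < g i * f w
          sooner = subst₂ _<_ (ι-* (e w) (+ Q i)) (ι-* (e i) (+ Q w)) (ι-mono-<
            (event-earlier {ζ = ζ} ∣ζ∣≡1 {range} {valueBound} {N} 1≤valueBound N-dominates {t w} {t i} {Q w} {Q i} {δ w} {δ i}
              (t-≤-range w) (t-≤-range i) (value-≤ K p q w) (value-≤ K p q i) (hit-earlier b′∈K off apart earlier)))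

        -- If h vanished at a point off the triples, it would be negative at a third point: that of
        -- the point's own block if this block is chosen, that of g₀ otherwise.
        zero-onTriple : ∀ b j → h (combine b j) ≡ 0ℚ → OnTriple b j
        zero-onTriple b j hi≡0 = cases (b ∈? K) (j Fin.≟ p) (j Fin.≟ q) (j Fin.≟ c)
          where
          open ℕ.≤-Reasoning
          ℓc = gap (τ p) (τ q) (τ c)
          far : b ∉ K → ratio ℕ.^ r ℕ.* ℓc ℕ.* bound j ℕ.< bound c ℕ.* gap (pos g₀ p) (pos g₀ q) (pos b j)
          far b∉K = begin-strict
            ratio ℕ.^ r ℕ.* ℓc ℕ.* bound j   ≤⟨ ℕ.*-monoʳ-≤ (ratio ℕ.^ r ℕ.* ℓc) (bound≤ j) ⟩
            ratio ℕ.^ r ℕ.* ℓc ℕ.* bound c   <⟨ ℕ.*-monoˡ-< (bound c) {{ℕ.>-nonZero bound-pos}} local ⟩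
            G ℕ.* G ℕ.* bound c              ≡⟨ ℕ.*-comm (G ℕ.* G) (bound c) ⟩
            bound c ℕ.* (G ℕ.* G)            ≤⟨ ℕ.*-monoʳ-≤ (bound c) (gap-other-block (λ b≡g₀ → b∉K (subst (_∈ K) (sym b≡g₀) g₀∈K)) p q j) ⟩
            bound c ℕ.* gap (pos g₀ p) (pos g₀ q) (pos b j) ∎
          cases : Dec (b ∈ K) → Dec (j ≡ p) → Dec (j ≡ q) → Dec (j ≡ c) → OnTriple b j
          cases (yes b∈K) (yes j≡p) _ _ = b∈K , inj₁ j≡p
          cases (yes b∈K) (no _) (yes j≡q) _ = b∈K , inj₂ (inj₁ j≡q)
          cases (yes b∈K) (no _) (no _) (yes j≡c) = b∈K , inj₂ (inj₂ j≡c)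
          cases (yes b∈K) (no j≢p) (no j≢q) (no j≢c) = contradiction hi≡0 (off-third b∈K (λ _ → j≢p , j≢q)
            (λ _ h≢b b≡h → h≢b (sym b≡h))
            (subst (λ x → ratio ℕ.^ r ℕ.* ℓc ℕ.* bound j ℕ.< bound c ℕ.* x)
              (sym (gap-same-block b p q j)) (first j j≢p j≢q j≢c)))
          cases (no b∉K) _ _ _ = contradiction hi≡0 (off-third g₀∈K (λ b∈K → contradiction b∈K b∉K)
            (λ h∈K _ b≡h → b∉K (subst (_∈ K) (sym b≡h) h∈K)) (far b∉K))

        F : Subset (r ℕ.* s)
        F = zeros h

        hu≡0 : h u ≡ 0ℚ
        hu≡0 = e₀ (f u) (g u)
          where
          e₀ : ∀ f g → (- g) * f + f * g ≡ 0ℚ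
          e₀ = solve-∀ ℚ-ring

        F-properFace : ProperFace v F
        -- The position `other` is off the triple, so h is nonzero there.
        F-properFace = zeros-properFace {v = v} h h-affine h≥0 (u , hu≡0) (combine g₀ other , other≢0)
          where
          other≢0 : h (combine g₀ other) ≢ 0ℚ
          other≢0 h≡0 = off (proj₂ (zero-onTriple g₀ other h≡0))
            where
            off : ¬ (other ≡ p ⊎ other ≡ q ⊎ other ≡ c)
            off (inj₁ ≡p) = proj₁ other≢ ≡p
            off (inj₂ (inj₁ ≡q)) = proj₁ (proj₂ other≢) ≡q
            off (inj₂ (inj₂ ≡c)) = proj₂ (proj₂ other≢) ≡c

        -- The pairs lie on the axis f = g = 0 of the pencil. As g u is negative, u is none of them,
        -- which makes 2 k + 1 points of F.
        pair∈F : ∀ {b j} → b ∈ K → j ≡ p ⊎ j ≡ q → combine b j ∈ F ∖ u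
        pair∈F {b} {j} b∈K j∈ = x∈p∧x≢y⇒x∈p-y (∈-zeros⁺ h hi≡0) i≢u
          where
          i = combine b j
          Qi≡0 : Q i ≡ 0
          Qi≡0 = value-zero b∈K j∈
          δi≡0 : δ i ≡ 0ℤ
          δi≡0 = trans (δ-combine b j) (depth≡0 j∈)
            where
            depth≡0 : j ≡ p ⊎ j ≡ q → depth j ≡ 0ℤ
            depth≡0 (inj₁ refl) = depth-p
            depth≡0 (inj₂ refl) = depth-q
          gi≡0 : g i ≡ 0ℚ
          gi≡0 = trans (cong₂ (λ Q δ → ι (event ζ N (t i) Q δ)) Qi≡0 δi≡0) (trans (cong ι (e₀ ζ (+ t i) (+ N))) ι-0)
            where
            e₀ : ∀ ζ t N → ζ ℤ.* (t ℤ.* 0ℤ) ℤ.- N ℤ.* 0ℤ ≡ 0ℤ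
            e₀ = ℤRing.solve-∀
          fi≡0 : f i ≡ 0ℚ
          fi≡0 = trans (cong (λ Q → ι (+ Q)) Qi≡0) ι-0
          hi≡0 : h i ≡ 0ℚ
          hi≡0 = trans (cong₂ (λ x y → - g u * x + f u * y) fi≡0 gi≡0) (e₀ (- g u) (f u))
            where
            e₀ : ∀ x y → x * 0ℚ + y * 0ℚ ≡ 0ℚ
            e₀ = solve-∀ ℚ-ring
          i≢u : i ≢ u
          i≢u i≡u = ℚ.<⇒≢ gu<0 (trans (cong g (sym i≡u)) gi≡0)

        F-facet : Facet v F
        F-facet = large-properFace-facet {v = v} generic k<n F-properFace (begin
          suc (k ℕ.* 2)         ≡⟨ cong (λ m → suc (m ℕ.* 2)) (sym ∣K∣≡k) ⟩
          suc (∣ K ∣ ℕ.* 2)     ≤⟨ s≤s (pairs-size K p≢q {F ∖ u} λ b∈K → pair∈F b∈K (inj₁ refl) , pair∈F b∈K (inj₂ refl)) ⟩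
          suc ∣ F ∖ u ∣         ≤⟨ x∈p⇒∣p-x∣<∣p∣ (∈-zeros⁺ h hu≡0) ⟩
          ∣ F ∣                 ∎)
          where open ℕ.≤-Reasoning

        F-onTriple : ∀ {i} → i ∈ F → ∃ λ b → ∃ λ j → combine b j ≡ i × OnTriple b j
        F-onTriple {i} i∈F = b , j , i≡ , zero-onTriple b j (trans (cong h i≡) (∈-zeros⁻ h i∈F))
          where
          b = proj₁ (remQuot {r} s i)
          j = proj₂ (remQuot {r} s i)
          i≡ = Fin.combine-remQuot {r} s i

      facet : ∃ λ F → Facet v F × (∀ {i} → i ∈ F → ∃ λ b → ∃ λ j → combine b j ≡ i × b ∈ K × (j ≡ p ⊎ j ≡ q ⊎ j ≡ c))
      facet = F , F-facet , F-onTriple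
        where
        rotation = rotate f g f≥0 (third g₀ , g-third<0)
        open Rotated (proj₁ rotation) (proj₁ (proj₂ rotation)) (proj₂ (proj₂ rotation))

-- Counting blocks

block : ∀ r {s} → Subset (r ℕ.* s) → Fin r → Subset s
block _ S g = tabulate λ j → lookup S (combine g j)

clear : ∀ {s} → List (Fin s) → Subset s → Bool
clear js B = all (λ j → not (lookup B j)) js

clearBlocks : ∀ r {s} → List (Fin s) → Subset (r ℕ.* s) → Subset r
clearBlocks r js S = tabulate λ g → clear js (block r S g)

clear-lookup : ∀ {s} (js : List (Fin s)) (B : Subset s) {j} → clear js B ≡ true → j ∈ₗ js → lookup B j ≡ false
clear-lookup (j List.∷ js) B eq (Any.here refl) with lookup B j
... | false = refl
clear-lookup (j List.∷ js) B eq (Any.there j∈) with lookup B j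
... | false = clear-lookup js B eq j∈

clearBlocks-∉ : ∀ r {s} (js : List (Fin s)) (S : Subset (r ℕ.* s)) {g j} →
  g ∈ clearBlocks r js S → j ∈ₗ js → combine g j ∉ S
clearBlocks-∉ r js S {g} {j} g∈ j∈ i∈S = contradiction
  (trans (sym ([]=⇒lookup i∈S)) (trans (sym (lookup∘tabulate (λ j → lookup S (combine g j)) j))
    (clear-lookup js (block r S g) (trans (sym (lookup∘tabulate (λ g → clear js (block r S g)) g)) ([]=⇒lookup g∈)) j∈)))
  λ ()

bit : Bool → ℕ
bit true = 1
bit false = 0

∣∷∣ : ∀ {n} b (p : Subset n) → ∣ b ∷ p ∣ ≡ bit b ℕ.+ ∣ p ∣
∣∷∣ true p = refl
∣∷∣ false p = refl

∣++∣ : ∀ {m n} (p : Subset m) (q : Subset n) → ∣ p ++ q ∣ ≡ ∣ p ∣ ℕ.+ ∣ q ∣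
∣++∣ [] q = refl
∣++∣ (inside ∷ p) q = cong suc (∣++∣ p q)
∣++∣ (outside ∷ p) q = ∣++∣ p q

sum-map-+ : ∀ {A : Set} (f g : A → ℕ) xs → sum (List.map (λ x → f x ℕ.+ g x) xs) ≡ sum (List.map f xs) ℕ.+ sum (List.map g xs)
sum-map-+ f g List.[] = refl
sum-map-+ f g (x List.∷ xs) rewrite sum-map-+ f g xs = e (f x) (g x) _ _
  where
  e : ∀ a b c d → a ℕ.+ b ℕ.+ (c ℕ.+ d) ≡ a ℕ.+ c ℕ.+ (b ℕ.+ d)
  e = ℕRing.solve-∀

-- A block pays w for each listed pattern that it avoids. Few blocks avoid a given pattern, so over
-- all blocks the payments stay bounded while r grows.
blockWeight : ∀ {s} → ℕ → List (List (Fin s)) → Subset s → ℕ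
blockWeight w jss B = ∣ B ∣ ℕ.+ w ℕ.* sum (List.map (λ js → bit (clear js B)) jss)

count-blocks : ∀ {s} (c w : ℕ) (jss : List (List (Fin s))) →
  (∀ B → c ℕ.≤ blockWeight w jss B) →
  ∀ r (S : Subset (r ℕ.* s)) → r ℕ.* c ℕ.≤ ∣ S ∣ ℕ.+ w ℕ.* sum (List.map (λ js → ∣ clearBlocks r js S ∣) jss)
count-blocks c w jss per-block zero S = z≤n
count-blocks {s} c w jss per-block (suc r) S with splitAt s S
... | B , S′ , refl = begin
  c ℕ.+ r ℕ.* c
    ≤⟨ ℕ.+-mono-≤ (per-block B) (count-blocks c w jss per-block r S′) ⟩
  (∣ B ∣ ℕ.+ w ℕ.* sum (List.map f jss)) ℕ.+ (∣ S′ ∣ ℕ.+ w ℕ.* sum (List.map f′ jss))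
    ≡⟨ e (∣ B ∣) w (sum (List.map f jss)) (∣ S′ ∣) (sum (List.map f′ jss)) ⟩
  ∣ B ∣ ℕ.+ ∣ S′ ∣ ℕ.+ w ℕ.* (sum (List.map f jss) ℕ.+ sum (List.map f′ jss))
    ≡⟨ cong₂ (λ x y → x ℕ.+ w ℕ.* y) (sym (∣++∣ B S′))
        (trans (sym (sum-map-+ f f′ jss)) (cong sum (map-cong split jss))) ⟩
  ∣ B ++ S′ ∣ ℕ.+ w ℕ.* sum (List.map (λ js → ∣ clearBlocks (suc r) js (B ++ S′) ∣) jss) ∎
  where
  open ℕ.≤-Reasoning
  f f′ : List (Fin s) → ℕ
  f js = bit (clear js B)
  f′ js = ∣ clearBlocks r js S′ ∣
  e : ∀ b w x s y → (b ℕ.+ w ℕ.* x) ℕ.+ (s ℕ.+ w ℕ.* y) ≡ b ℕ.+ s ℕ.+ w ℕ.* (x ℕ.+ y)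
  e = ℕRing.solve-∀
  head-block : block (suc r) (B ++ S′) zero ≡ B
  head-block = trans (tabulate-cong (λ j → lookup-++ˡ B S′ j)) (tabulate∘lookup B)
  tail-block : ∀ g → block (suc r) (B ++ S′) (suc g) ≡ block r S′ g
  tail-block g = tabulate-cong (λ j → lookup-++ʳ B S′ (combine g j))
  split : ∀ js → f js ℕ.+ f′ js ≡ ∣ clearBlocks (suc r) js (B ++ S′) ∣
  split js = sym (trans (∣∷∣ (clear js (block (suc r) (B ++ S′) zero)) (tabulate λ g → clear js (block (suc r) (B ++ S′) (suc g))))
    (cong₂ (λ x y → bit (clear js x) ℕ.+ ∣ y ∣) head-block (tabulate-cong (λ g → cong (clear js) (tail-block g)))))

nonempty : ∀ {n} (K : Subset n) → 0 ℕ.< ∣ K ∣ → ∃ λ g → g ∈ K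
nonempty (inside ∷ K) _ = zero , here
nonempty (outside ∷ K) K>0 with nonempty K K>0
... | g , g∈K = suc g , there g∈K

-- Even dimension

module EvenCurve (r k′ N : ℕ) (1≤r : 1 ℕ.≤ r) (k<r : suc (suc k′) ℕ.< r)
                 (N-large : threshold r 1 (suc (suc k′) ℕ.* 2) ℕ.< N) where

  open Blocks {r} {2} toℕ 1 1≤r ℕ.≤-refl (λ j → ℕ.≤-pred (Fin.toℕ<n j)) Fin.toℕ-injective

  k d₀ : ℕ
  k = suc (suc k′)
  -- Written out so that `suc d₀` and `k * 2` agree by computation.
  d₀ = suc (suc (suc (k′ ℕ.* 2)))

  open Curve d₀ t (λ _ → 0ℤ) N public

  d<n : suc d₀ ℕ.< r ℕ.* 2
  d<n = ℕ.*-monoˡ-< 2 k<r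

  generic : GeneralPosition v
  generic = generalPosition (ℕ.1≤n! range) (ℕ.≤-<-trans (ℕ.m≤m+n _ _) N-large) range!-divisible

  simplicial : SimplicialPolytope v
  simplicial = generic-fullDimensional {v = v} generic d<n ,
    vertex t-injective (s≤s (s≤s z≤n)) (ℕ.≤-trans (s≤s (s≤s z≤n)) d<n) ,
    λ F → facet-size {v = v} generic d<n

  neighbours : ∀ j → SameSide 0 1 (toℕ {2} j)
  neighbours zero = inj₁ (z≤n , z≤n)
  neighbours (suc zero) = inj₂ (z≤n , ℕ.≤-refl)

  module PairFacet (K : Subset r) (∣K∣≡k : ∣ K ∣ ≡ k) where

    Q : Fin (r ℕ.* 2) → ℕ
    Q = value K zero (suc zero)

    f : Fin (r ℕ.* 2) → ℚ
    f i = ι (+ Q i)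

    F : Subset (r ℕ.* 2)
    F = zeros f

    f-affine : Affine v f
    f-affine = affine-cong {v = v} (λ i → trans
        (cong₂ (λ x y → x + 1ℚ * y) (value-poly K neighbours i) (trans (cong ι (ℤ.*-zeroʳ (+ N))) ι-0))
        (e (f i)))
      (lead-affine (subst (λ m → Lead (m ℕ.* 2) 1ℚ P) ∣K∣≡k (pairPoly-lead K _ _)))
      where
      P = pairPoly K (λ g → pos g zero) (λ g → pos g (suc zero))
      e : ∀ x → x + 1ℚ * 0ℚ ≡ x
      e = solve-∀ ℚ-ring

    f≥0 : ∀ i → 0ℚ ≤ f i
    f≥0 i = subst (_≤ f i) ι-0 (ι-mono-≤ (ℤ.+≤+ z≤n))

    F-blocks : ∀ {b j} → combine b j ∈ F → b ∈ K
    F-blocks {b} {j} i∈F = decidable-stable (b ∈? K) λ b∉K →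
      ℕ.<⇒≢ (value-pos K {zero} {suc zero} {b} {j} (λ b∈K → contradiction b∈K b∉K))
        (sym (ℤ.+-injective (ι-injective (trans (∈-zeros⁻ f i∈F) (sym ι-0)))))

    pair∈F : ∀ {b j} → b ∈ K → j ≡ zero ⊎ j ≡ suc zero → combine b j ∈ F
    pair∈F b∈K j∈ = ∈-zeros⁺ f (trans (cong (λ x → ι (+ x)) (value-zero b∈K j∈)) ι-0)

    F-facet : Facet v F
    F-facet = large-properFace-facet {v = v} generic d<n
      (affine-properFace {v = v} {f} f-affine f≥0 (λ i → mk⇔ (∈-zeros⁺ f) (∈-zeros⁻ f))
        (_ , pair∈F (proj₂ (nonempty K (subst (0 ℕ.<_) (sym ∣K∣≡k) (s≤s z≤n)))) (inj₁ refl))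
        (combine b zero , λ i∈F → b∉K (F-blocks {b} {zero} i∈F)))
      (subst (λ m → m ℕ.* 2 ℕ.≤ ∣ F ∣) ∣K∣≡k
        (pairs-size K {zero} {suc zero} (λ ()) λ b∈K → pair∈F b∈K (inj₁ refl) , pair∈F b∈K (inj₂ refl)))
      where
      b = proj₁ (missing K (subst (ℕ._< r) (sym ∣K∣≡k) k<r))
      b∉K = proj₂ (missing K (subst (ℕ._< r) (sym ∣K∣≡k) k<r))

  transversal-size : ∀ S → Transversal v S → r ℕ.* 1 ℕ.≤ ∣ S ∣ ℕ.+ k
  transversal-size S transversal = ℕ.≤-trans
    (count-blocks 1 1 (pair List.∷ List.[]) (λ B → decidable-stable (1 ℕ.≤? _) (λ ¬1≤ → no-bad (B , ¬1≤))) r S)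
    (ℕ.+-monoʳ-≤ ∣ S ∣ (ℕ.≤-trans (ℕ.≤-reflexive (e ∣ clearBlocks r pair S ∣)) few))
    where
    pair : List (Fin 2)
    pair = zero List.∷ suc zero List.∷ List.[]
    no-bad : ¬ ∃ λ (B : Subset 2) → ¬ (1 ℕ.≤ blockWeight 1 (pair List.∷ List.[]) B)
    no-bad = from-no (anySubset? λ B → ¬? (1 ℕ.≤? blockWeight 1 (pair List.∷ List.[]) B))
    e : ∀ x → 1 ℕ.* (x ℕ.+ 0) ≡ x
    e = ℕRing.solve-∀
    few : ∣ clearBlocks r pair S ∣ ℕ.≤ k
    few = ℕ.≮⇒≥ λ k<K → impossible (subset-of-size (clearBlocks r pair S) (ℕ.<⇒≤ k<K))
      where
      impossible : ¬ ∃ λ L → L ⊆ clearBlocks r pair S × ∣ L ∣ ≡ k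
      impossible (K , K⊆ , ∣K∣≡k) =
        clearBlocks-∉ r pair S (K⊆ (PairFacet.F-blocks K ∣K∣≡k (subst (_∈ PairFacet.F K ∣K∣≡k) (sym i≡) i∈F))) (all∈ j)
          (subst (_∈ S) (sym i≡) i∈S)
        where
        hit = transversal (PairFacet.F K ∣K∣≡k) (PairFacet.F-facet K ∣K∣≡k)
        i = proj₁ hit
        i∈S = proj₁ (proj₂ hit)
        i∈F = proj₂ (proj₂ hit)
        b = proj₁ (remQuot {r} 2 i)
        j = proj₂ (remQuot {r} 2 i)
        i≡ : combine b j ≡ i
        i≡ = Fin.combine-remQuot {r} 2 i
        all∈ : ∀ j → j ∈ₗ pair
        all∈ zero = Any.here refl
        all∈ (suc zero) = Any.there (Any.here refl)

-- Odd dimension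

-- The long step to τ 4 and the low point σ 2 provide the margin W in each of the three triples.
module Quintuple (W : ℕ) (1≤W : 1 ℕ.≤ W) where

  Y G : ℕ
  -- 6 = 3 * 2 is the gap of position 3 to the pair 0, 1; position 4 must be farther by a factor
  -- above W.
  Y = 6 ℕ.* W
  -- The gaps of the three triples, 2, 6 and 2 + Y, are at most 4 + Y, so W times any of them is at
  -- most G and hence below G * G.
  G = W ℕ.* (4 ℕ.+ Y)

  τ : Fin 5 → ℕ
  τ 0F = 0
  τ 1F = 1
  τ 2F = 2
  τ 3F = 3
  τ 4F = 4 ℕ.+ Y

  σ : Fin 5 → ℤ
  σ 0F = 0ℤ
  σ 1F = 0ℤ
  -- Seen from height 1, position 2 has depth W + 1 against depth 1 at positions 0 and 1.
  σ 2F = ℤ.- + W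
  σ 3F = + 1
  σ 4F = + 1

  τ-injective : ∀ {i j} → τ i ≡ τ j → i ≡ j
  τ-injective {i} {j} eq = trans (sym (decode-τ i)) (trans (cong decode eq) (decode-τ j))
    where
    decode : ℕ → Fin 5
    decode 0 = 0F
    decode 1 = 1F
    decode 2 = 2F
    decode 3 = 3F
    decode _ = 4F
    decode-τ : ∀ j → decode (τ j) ≡ j
    decode-τ 0F = refl
    decode-τ 1F = refl
    decode-τ 2F = refl
    decode-τ 3F = refl
    decode-τ 4F = refl

  τ≤4+Y : ∀ j → τ j ℕ.≤ 4 ℕ.+ Y
  τ≤4+Y 0F = z≤n
  τ≤4+Y 1F = s≤s z≤n
  τ≤4+Y 2F = s≤s (s≤s z≤n)
  τ≤4+Y 3F = s≤s (s≤s (s≤s z≤n))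
  τ≤4+Y 4F = ℕ.≤-refl

  4+Y≤G : 4 ℕ.+ Y ℕ.≤ G
  4+Y≤G = ℕ.m≤n*m (4 ℕ.+ Y) W {{ℕ.>-nonZero 1≤W}}

  τ≤G : ∀ j → τ j ℕ.≤ G
  τ≤G j = ℕ.≤-trans (τ≤4+Y j) 4+Y≤G

  1≤G : 1 ℕ.≤ G
  1≤G = ℕ.≤-trans (s≤s z≤n) 4+Y≤G

  6≤Y : 6 ℕ.≤ Y
  6≤Y = ℕ.*-monoʳ-≤ 6 1≤W

  below-G*G : ∀ {ℓ} → ℓ ℕ.≤ 4 ℕ.+ Y → W ℕ.* ℓ ℕ.< G ℕ.* G
  below-G*G ℓ≤ = ℕ.≤-<-trans (ℕ.*-monoʳ-≤ W ℓ≤)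
    (ℕ.m<m*n G G {{ℕ.>-nonZero 1≤G}} (ℕ.≤-trans (s≤s (s≤s z≤n)) 4+Y≤G))

  x*0< : ∀ x {y} → 0 ℕ.< y → x ℕ.* 0 ℕ.< y
  x*0< x {y} = subst (ℕ._< y) (sym (ℕ.*-zeroʳ x))

  negate : ∀ w → + 1 ℤ.* (0ℤ ℤ.- ℤ.- w) ≡ w
  negate = ℤRing.solve-∀

  -- Position 2 is the only one below the height of the pair, so it has no rival in the block.
  triple₀₁₂ : Triple τ σ W G
  triple₀₁₂ = record
    { p = 0F ; q = 1F ; c = 2F ; other = 3F
    ; p≢q = λ () ; c≢p = λ () ; c≢q = λ () ; other≢ = (λ ()) , (λ ()) , λ ()
    ; neighbours = λ where
        0F → inj₁ (z≤n , z≤n)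
        1F → inj₂ (z≤n , s≤s z≤n)
        2F → inj₂ (z≤n , s≤s z≤n)
        3F → inj₂ (z≤n , s≤s z≤n)
        4F → inj₂ (z≤n , s≤s z≤n)
    ; ζ = + 1 ; a = 0ℤ ; ∣ζ∣≡1 = refl ; depth-p = refl ; depth-q = refl
    ; bound = λ { 2F → W ; _ → 0 }
    ; depth≤ = λ where
        0F → ℤ.≤-refl
        1F → ℤ.≤-refl
        2F → ℤ.≤-reflexive (negate (+ W))
        3F → ℤ.-≤+
        4F → ℤ.-≤+
    ; depth-c = negate (+ W)
    ; bound-pos = 1≤W
    ; bound≤ = λ where
        0F → z≤n
        1F → z≤n
        2F → ℕ.≤-refl
        3F → z≤n
        4F → z≤n
    ; first = λ where
        0F ≢p _ _ → contradiction refl ≢p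
        1F _ ≢q _ → contradiction refl ≢q
        2F _ _ ≢c → contradiction refl ≢c
        3F _ _ _ → x*0< (W ℕ.* 2) (ℕ.*-mono-≤ 1≤W (s≤s z≤n))
        4F _ _ _ → x*0< (W ℕ.* 2) (ℕ.*-mono-≤ 1≤W (s≤s z≤n))
    ; local = below-G*G (s≤s (s≤s z≤n))
    }

  -- In the opposite direction positions 3 and 4 both have depth 1, and only distance separates
  -- them: (4 + Y)(3 + Y) exceeds 6 W.
  triple₀₁₃ : Triple τ σ W G
  triple₀₁₃ = record
    { p = 0F ; q = 1F ; c = 3F ; other = 2F
    ; p≢q = λ () ; c≢p = λ () ; c≢q = λ () ; other≢ = (λ ()) , (λ ()) , λ ()
    ; neighbours = Triple.neighbours triple₀₁₂
    ; ζ = ℤ.- + 1 ; a = 0ℤ ; ∣ζ∣≡1 = refl ; depth-p = refl ; depth-q = refl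
    ; bound = λ { 3F → 1 ; 4F → 1 ; _ → 0 }
    ; depth≤ = λ where
        0F → ℤ.≤-refl
        1F → ℤ.≤-refl
        2F → subst (ℤ._≤ 0ℤ) (sym (keep (ℤ.- + W))) (ℤ.neg-mono-≤ (ℤ.+≤+ (z≤n {W})))
        3F → ℤ.≤-refl
        4F → ℤ.≤-refl
    ; depth-c = refl
    ; bound-pos = s≤s z≤n
    ; bound≤ = λ where
        0F → z≤n
        1F → z≤n
        2F → z≤n
        3F → ℕ.≤-refl
        4F → ℕ.≤-refl
    ; first = λ where
        0F ≢p _ _ → contradiction refl ≢p
        1F _ ≢q _ → contradiction refl ≢q
        2F _ _ _ → x*0< (W ℕ.* 6) (s≤s z≤n)
        3F _ _ ≢c → contradiction refl ≢c
        4F _ _ _ → far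
    ; local = below-G*G (ℕ.≤-trans 6≤Y (ℕ.m≤n+m Y 4))
    }
    where
    keep : ∀ w → (ℤ.- + 1) ℤ.* (0ℤ ℤ.- w) ≡ w
    keep = ℤRing.solve-∀
    e : ∀ W → W ℕ.* 6 ℕ.* 1 ≡ 6 ℕ.* W
    e = ℕRing.solve-∀
    far : W ℕ.* 6 ℕ.* 1 ℕ.< 1 ℕ.* ((4 ℕ.+ Y) ℕ.* (3 ℕ.+ Y))
    far = subst₂ ℕ._<_ (sym (e W)) (sym (ℕ.*-identityˡ ((4 ℕ.+ Y) ℕ.* (3 ℕ.+ Y))))
      (ℕ.<-≤-trans (ℕ.m<n+m Y {4} (s≤s z≤n)) (ℕ.m≤m*n (4 ℕ.+ Y) (3 ℕ.+ Y)))

  -- Positions 0, 1 and 2 all lie below this pair. Position 2 is the nearest, and its depth alone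
  -- supplies the factor above W.
  triple₃₄₂ : Triple τ σ W G
  triple₃₄₂ = record
    { p = 3F ; q = 4F ; c = 2F ; other = 0F
    ; p≢q = λ () ; c≢p = λ () ; c≢q = λ () ; other≢ = (λ ()) , (λ ()) , λ ()
    ; neighbours = λ where
        0F → inj₁ (z≤n , z≤n)
        1F → inj₁ (s≤s z≤n , s≤s z≤n)
        2F → inj₁ (s≤s (s≤s z≤n) , s≤s (s≤s z≤n))
        3F → inj₁ (ℕ.≤-refl , s≤s (s≤s (s≤s z≤n)))
        4F → inj₂ (s≤s (s≤s (s≤s z≤n)) , ℕ.≤-refl)
    ; ζ = + 1 ; a = + 1 ; ∣ζ∣≡1 = refl ; depth-p = refl ; depth-q = refl
    ; bound = λ { 0F → 1 ; 1F → 1 ; 2F → suc W ; _ → 0 }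
    ; depth≤ = λ where
        0F → ℤ.≤-refl
        1F → ℤ.≤-refl
        2F → ℤ.≤-reflexive (raise (+ W))
        3F → ℤ.≤-refl
        4F → ℤ.≤-refl
    ; depth-c = raise (+ W)
    ; bound-pos = s≤s z≤n
    ; bound≤ = λ where
        0F → s≤s z≤n
        1F → s≤s z≤n
        2F → ℕ.≤-refl
        3F → z≤n
        4F → z≤n
    ; first = λ where
        0F _ _ _ → smaller (ℕ.m≤n⇒m≤n+o _ (ℕ.m≤n+m (2 ℕ.+ Y) 2))
        1F _ _ _ → smaller (ℕ.m≤n⇒m≤n+o _ (ℕ.m≤n+m (2 ℕ.+ Y) 1))
        2F _ _ ≢c → contradiction refl ≢c
        3F ≢p _ _ → contradiction refl ≢p
        4F _ ≢q _ → contradiction refl ≢q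
    ; local = below-G*G (ℕ.≤-trans (ℕ.≤-reflexive (ℕ.+-identityʳ (2 ℕ.+ Y))) (ℕ.m≤n+m (2 ℕ.+ Y) 2))
    }
    where
    raise : ∀ w → + 1 ℤ.* (+ 1 ℤ.- ℤ.- w) ≡ + 1 ℤ.+ w
    raise = ℤRing.solve-∀
    smaller : ∀ {ℓ} → 2 ℕ.+ Y ℕ.≤ ℓ → W ℕ.* (1 ℕ.* (2 ℕ.+ Y)) ℕ.* 1 ℕ.< suc W ℕ.* ℓ
    smaller {ℓ} ≤ℓ = begin-strict
      W ℕ.* (1 ℕ.* (2 ℕ.+ Y)) ℕ.* 1   ≡⟨ e W (2 ℕ.+ Y) ⟩
      W ℕ.* (2 ℕ.+ Y)                 <⟨ ℕ.m<n+m (W ℕ.* (2 ℕ.+ Y)) (s≤s z≤n) ⟩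
      suc W ℕ.* (2 ℕ.+ Y)             ≤⟨ ℕ.*-monoʳ-≤ (suc W) ≤ℓ ⟩
      suc W ℕ.* ℓ                     ∎
      where
      open ℕ.≤-Reasoning
      e : ∀ W x → W ℕ.* (1 ℕ.* x) ℕ.* 1 ≡ W ℕ.* x
      e = ℕRing.solve-∀

separation : ℕ → ℕ
separation r = ((2 ℕ.* r) ℕ.* (2 ℕ.* r)) ℕ.^ r

module OddPolytope (r k N : ℕ) (1≤r : 1 ℕ.≤ r) (1≤k : 1 ℕ.≤ k) (k<r : k ℕ.< r) (1≤W : 1 ℕ.≤ separation r)
                   (N-large : threshold r (Quintuple.G (separation r) 1≤W) (suc (k ℕ.* 2)) ℕ.< N) where

  open Quintuple (separation r) 1≤W
  open OddCurve {r} {5} τ σ G 1≤r 1≤G τ≤G τ-injective k N N-large public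

  d<n : suc (k ℕ.* 2) ℕ.< r ℕ.* 5
  d<n = ℕ.≤-trans (s≤s (s≤s (ℕ.*-monoʳ-≤ k (s≤s (s≤s z≤n)))))
    (ℕ.≤-trans (ℕ.+-monoˡ-≤ (k ℕ.* 5) (s≤s (s≤s z≤n))) (ℕ.*-monoˡ-≤ 5 k<r))

  simplicial : 2 ℕ.≤ k ℕ.* 2 → SimplicialPolytope v
  simplicial 2≤k*2 = generic-fullDimensional {v = v} generic d<n ,
    vertex t-injective 2≤k*2 (ℕ.≤-trans (s≤s (s≤s z≤n)) d<n) ,
    λ F → facet-size {v = v} generic d<n

  few-clear : (triple : Triple τ σ (separation r) G) (let open Triple triple) → ∀ S → Transversal v S →
    ∣ clearBlocks r (p List.∷ q List.∷ c List.∷ List.[]) S ∣ ℕ.≤ k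
  few-clear triple S transversal = ℕ.≮⇒≥ λ k<K → impossible (subset-of-size (clearBlocks r js S) (ℕ.<⇒≤ k<K))
    where
    open Triple triple
    js : List (Fin 5)
    js = p List.∷ q List.∷ c List.∷ List.[]
    listed : ∀ {j} → j ≡ p ⊎ j ≡ q ⊎ j ≡ c → j ∈ₗ js
    listed (inj₁ ≡p) = Any.here ≡p
    listed (inj₂ (inj₁ ≡q)) = Any.there (Any.here ≡q)
    listed (inj₂ (inj₂ ≡c)) = Any.there (Any.there (Any.here ≡c))
    impossible : ¬ ∃ λ L → L ⊆ clearBlocks r js S × ∣ L ∣ ≡ k
    impossible (K , K⊆ , ∣K∣≡k) = clearBlocks-∉ r js S (K⊆ b∈K) (listed onTriple) (subst (_∈ S) (sym i≡) i∈S)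
      where
      start = nonempty K (subst (0 ℕ.<_) (sym ∣K∣≡k) 1≤k)
      facet = TripleFacet.facet triple K ∣K∣≡k (proj₁ start) (proj₂ start) d<n
      hit = transversal (proj₁ facet) (proj₁ (proj₂ facet))
      i∈S = proj₁ (proj₂ hit)
      located = proj₂ (proj₂ facet) (proj₂ (proj₂ hit))
      i≡ = proj₁ (proj₂ (proj₂ located))
      b∈K = proj₁ (proj₂ (proj₂ (proj₂ located)))
      onTriple = proj₂ (proj₂ (proj₂ (proj₂ located)))

  transversal-size : ∀ S → Transversal v S → r ℕ.* 2 ℕ.≤ ∣ S ∣ ℕ.+ 2 ℕ.* (k ℕ.+ (k ℕ.+ (k ℕ.+ 0)))
  transversal-size S transversal = ℕ.≤-trans
    (count-blocks 2 2 jss (λ B → decidable-stable (2 ℕ.≤? blockWeight 2 jss B) λ light → no-light (B , light)) r S)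
    (ℕ.+-monoʳ-≤ ∣ S ∣ (ℕ.*-monoʳ-≤ 2 (ℕ.+-mono-≤ (few-clear triple₀₁₂ S transversal)
      (ℕ.+-mono-≤ (few-clear triple₀₁₃ S transversal) (ℕ.+-mono-≤ (few-clear triple₃₄₂ S transversal) z≤n)))))
    where
    jss : List (List (Fin 5))
    jss = (0F List.∷ 1F List.∷ 2F List.∷ List.[]) List.∷ (0F List.∷ 1F List.∷ 3F List.∷ List.[])
      List.∷ (3F List.∷ 4F List.∷ 2F List.∷ List.[]) List.∷ List.[]
    no-light : ¬ ∃ λ (B : Subset 5) → ¬ (2 ℕ.≤ blockWeight 2 jss B)
    -- Exhaustive check of 32 subsets: one with at most one point misses some triple, and one
    -- payment of 2 suffices.
    no-light = from-no (anySubset? λ B → ¬? (2 ℕ.≤? blockWeight 2 jss B))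

-- The limit superior

*-denominator : ∀ ε → ε * ι (↧ ε) ≡ ι (↥ ε)
*-denominator ε@(mkℚ n d-1 _) = ℚ.toℚᵘ-injective (ℚᵘ.≃-trans (ℚ.toℚᵘ-homo-* ε (ι (+ suc d-1)))
  (ℚᵘ.≃-trans (ℚᵘ.*-cong {toℚᵘ ε} ℚᵘ.≃-refl (toℚᵘ-ι (+ suc d-1)))
    (ℚᵘ.≃-trans (*≡* (e n d-1)) (ℚᵘ.≃-sym (toℚᵘ-ι n)))))
  where
  e : ∀ n m → n ℤ.* + suc m ℤ.* + 1 ≡ n ℤ.* + (suc m ℕ.* 1)
  e n m = trans (ℤ.*-identityʳ (n ℤ.* + suc m)) (cong (λ k → n ℤ.* + k) (sym (ℕ.*-identityʳ (suc m))))

-- The numerator of ε is at least 1, so B times the denominator will do.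
archimedean : ∀ ε → Positive ε → ∀ B → ∃ λ m → ∀ r → m ℕ.≤ r → ι (+ B) ≤ ε * ι (+ r)
archimedean ε ε>0 B = B ℕ.* ↧ₙ ε , λ r m≤r → begin
  ι (+ B)                              ≡⟨ sym (ℚ.*-identityˡ (ι (+ B))) ⟩
  1ℚ * ι (+ B)                         ≤⟨ ℚ.*-monoʳ-≤-nonNeg (ι (+ B)) {{nonNegative (ι≥0 B)}} 1≤n ⟩
  ι (↥ ε) * ι (+ B)                    ≡⟨ cong (_* ι (+ B)) (sym (*-denominator ε)) ⟩
  ε * ι (↧ ε) * ι (+ B)                ≡⟨ e ε (ι (↧ ε)) (ι (+ B)) ⟩
  ε * (ι (+ B) * ι (↧ ε))              ≡⟨ cong (ε *_) (trans (sym (ι-* (+ B) (↧ ε))) (cong ι (sym (ℤ.pos-* B (↧ₙ ε))))) ⟩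
  ε * ι (+ (B ℕ.* ↧ₙ ε))               ≤⟨ ℚ.*-monoˡ-≤-nonNeg ε {{ℚ.pos⇒nonNeg ε {{ε>0}}}} (ι-mono-≤ (ℤ.+≤+ m≤r)) ⟩
  ε * ι (+ r)                          ∎
  where
  open ℚ.≤-Reasoning
  ι≥0 : ∀ k → 0ℚ ≤ ι (+ k)
  ι≥0 k = subst (_≤ ι (+ k)) ι-0 (ι-mono-≤ (ℤ.+≤+ z≤n))
  e : ∀ a b c → a * b * c ≡ a * (c * b)
  e = solve-∀ ℚ-ring
  n>0 : 0ℚ < ι (↥ ε)
  n>0 = subst (0ℚ <_) (*-denominator ε) (0<* (ℚ.positive⁻¹ ε {{ε>0}})
    (subst (_< ι (↧ ε)) ι-0 (ι-mono-< (ℤ.+<+ (s≤s z≤n)))))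
  1≤n : 1ℚ ≤ ι (↥ ε)
  1≤n = subst (_≤ ι (↥ ε)) ι-1 (ι-mono-≤ (ℤ.i<j⇒suc[i]≤j (ℤ.≰⇒> λ n≤0 →
    <⇒≱ n>0 (subst (ι (↥ ε) ≤_) ι-0 (ι-mono-≤ n≤0)))))

-- A loss B that does not grow with r vanishes in the limit: B ≤ ε r ≤ ε n once r is large.
tauPAtLeast : ∀ {d α β B m₀ c} → c * ι (+ β) ≡ ι (+ α) → 1 ℕ.≤ β →
  (∀ r → m₀ ℕ.≤ r → Σ (Config d (r ℕ.* β)) λ v → SimplicialPolytope v ×
    (∀ S → Transversal v S → r ℕ.* α ℕ.≤ ∣ S ∣ ℕ.+ B)) →
  TauPAtLeast d c
tauPAtLeast {d} {α} {β} {B} {m₀} {c} cβ≡α 1≤β polytopes ε ε>0 N₀ =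
  r ℕ.* β , N₀≤n , v , proj₁ (proj₂ polytope) , λ S transversal →
    subst₂ _≤_ (cong ((c - ε) *_) (ι-def (+ (r ℕ.* β)))) (ι-def (+ ∣ S ∣))
      -- The difference of the two sides is a sum of three nonnegative terms: the slack of the
      -- transversal bound, ε r - B, and ε r (β - 1).
      (≤-from-0≤ (subst (0ℚ ≤_) (rearranged (∣ S ∣)) (0≤+ (0≤+
        (0≤-from-≤ (ι-mono-≤ (ℤ.+≤+ (proj₂ (proj₂ polytope) S transversal))))
        (0≤-from-≤ large))
        (0≤* (ℚ.≤-trans (ι≥0 B) large) (0≤-from-≤ (ι-mono-≤ (ℤ.+≤+ 1≤β)))))))
  where
  m = proj₁ (archimedean ε ε>0 B)
  r = m ℕ.+ N₀ ℕ.+ m₀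
  polytope = polytopes r (ℕ.m≤n+m m₀ (m ℕ.+ N₀))
  v = proj₁ polytope
  N₀≤n : N₀ ℕ.≤ r ℕ.* β
  N₀≤n = ℕ.≤-trans (ℕ.≤-trans (ℕ.m≤n+m N₀ m) (ℕ.m≤m+n (m ℕ.+ N₀) m₀)) (ℕ.m≤m*n r β {{ℕ.>-nonZero 1≤β}})
  large : ι (+ B) ≤ ε * ι (+ r)
  large = proj₂ (archimedean ε ε>0 B) r (ℕ.≤-trans (ℕ.m≤m+n m N₀) (ℕ.m≤m+n (m ℕ.+ N₀) m₀))
  ι≥0 : ∀ k → 0ℚ ≤ ι (+ k)
  ι≥0 k = subst (_≤ ι (+ k)) ι-0 (ι-mono-≤ (ℤ.+≤+ z≤n))
  ι-*ℕ : ∀ a b → ι (+ (a ℕ.* b)) ≡ ι (+ a) * ι (+ b)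
  ι-*ℕ a b = trans (cong ι (ℤ.pos-* a b)) (ι-* (+ a) (+ b))
  e : ∀ s B r c β ε → (s + B - r * (c * β)) + (ε * r - B) + ε * r * (β - 1ℚ) ≡ s - (c - ε) * (r * β)
  e = solve-∀ ℚ-ring
  rearranged : ∀ s → (ι (+ (s ℕ.+ B)) - ι (+ (r ℕ.* α))) + (ε * ι (+ r) - ι (+ B)) + ε * ι (+ r) * (ι (+ β) - ι (+ 1))
    ≡ ι (+ s) - (c - ε) * ι (+ (r ℕ.* β))
  rearranged s = begin
    (ι (+ (s ℕ.+ B)) - ι (+ (r ℕ.* α))) + x + y * (ι (+ β) - ι (+ 1))
      ≡⟨ cong₂ (λ a b → a + x + y * (ι (+ β) - b))
          (cong₂ _-_ (ι-+ (+ s) (+ B)) (trans (ι-*ℕ r α) (cong (ι (+ r) *_) (sym cβ≡α)))) ι-1 ⟩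
    (ι (+ s) + ι (+ B) - ι (+ r) * (c * ι (+ β))) + x + y * (ι (+ β) - 1ℚ)
      ≡⟨ e (ι (+ s)) (ι (+ B)) (ι (+ r)) c (ι (+ β)) ε ⟩
    ι (+ s) - (c - ε) * (ι (+ r) * ι (+ β))
      ≡⟨ cong (λ z → ι (+ s) - (c - ε) * z) (sym (ι-*ℕ r β)) ⟩
    ι (+ s) - (c - ε) * ι (+ (r ℕ.* β)) ∎
    where
    open ≡-Reasoning
    x = ε * ι (+ r) - ι (+ B)
    y = ε * ι (+ r)

even-tau : ∀ k′ → TauPAtLeast (suc (suc k′) ℕ.* 2) (+ 1 / 2)
even-tau k′ = tauPAtLeast {α = 1} {2} {suc (suc k′)} {suc (suc (suc k′))} {+ 1 / 2}
  (trans (cong (+ 1 / 2 *_) (ι-def (+ 2))) (trans refl (sym (ι-def (+ 1))))) (s≤s z≤n) λ r k<r →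
    -- The final `≤-refl` determines N as the successor of the threshold.
    let open EvenCurve r k′ _ (ℕ.≤-trans (s≤s z≤n) k<r) k<r ℕ.≤-refl
    in v , simplicial , transversal-size

odd-tau : ∀ k → 2 ℕ.≤ k → TauPAtLeast (suc (k ℕ.* 2)) (+ 2 / 5)
odd-tau k 2≤k = tauPAtLeast {α = 2} {5} {2 ℕ.* (k ℕ.+ (k ℕ.+ (k ℕ.+ 0)))} {suc k} {+ 2 / 5}
  (trans (cong (+ 2 / 5 *_) (ι-def (+ 5))) (trans refl (sym (ι-def (+ 2))))) (s≤s z≤n) λ r k<r →
    let open OddPolytope r k _ (ℕ.≤-trans (s≤s z≤n) k<r) (ℕ.≤-trans (s≤s z≤n) 2≤k) k<r (1≤W r (ℕ.≤-trans (s≤s z≤n) k<r))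
          ℕ.≤-refl
    in v , simplicial (ℕ.≤-trans 2≤k (ℕ.m≤m*n k 2)) , transversal-size
  where
  1≤W : ∀ r → 1 ℕ.≤ r → 1 ℕ.≤ separation r
  1≤W r 1≤r = ℕ.m^n>0 ((2 ℕ.* r) ℕ.* (2 ℕ.* r)) {{ℕ.>-nonZero (ℕ.*-mono-≤ 2r≥1 2r≥1)}} r
    where 2r≥1 = ℕ.≤-trans 1≤r (ℕ.m≤m+n r (r ℕ.+ 0))

theorem4p12 : ∀ (k : ℕ) → 2 ℕ.≤ k →
    TauPAtLeast (2 ℕ.* k) (+ 1 / 2) × TauPAtLeast (2 ℕ.* k ℕ.+ 1) (+ 2 / 5)
theorem4p12 k@(suc (suc k′)) 2≤k@(s≤s (s≤s _)) =
  subst (λ d → TauPAtLeast d (+ 1 / 2)) (ℕ.*-comm k 2) (even-tau k′) ,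
  subst (λ d → TauPAtLeast d (+ 2 / 5)) (trans (cong suc (ℕ.*-comm k 2)) (sym (ℕ.+-comm (2 ℕ.* k) 1))) (odd-tau k 2≤k)
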